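{- Let $b$ be a nonzero integer and let $k\geq -1$ be an integer with $k\in\chi(0,b)$. Let $p$ be an odd prime that is a $k$-PL prime relative to $(0,b)$. Let $H$ be a graph of order $\pi_p(0,b)-1$ and size $m$, and let $G$ be a connected graph of order $\pi_p(0,b)-1$ and size $(k+1)\bigl(m+\pi_p(0,b)-1\bigr)+\varepsilon$, where $\varepsilon\in\{ -1,0,1\}$. If $p\equiv\pm1\pmod 8$ or $m=0$, then the corona graph $G\circ H$ is a $(0,b)$-FLC graph modulo $p$.
   Context: All graphs are finite and simple with nonempty vertex set; order means number of vertices and size means number of edges. For integers $a,b$, the $(a,b)$-Fibonacci sequence is $F_0=a$, $F_1=b$, $F_n=F_{n-1}+F_{n-2}$ for $n\ge 2$. $(x/p)$ denotes the Legendre symbol for an odd prime $p$ (equal to $0$ when $p\mid x$). The $(a,b)$-Pisano period $\pi_p(a,b)$ is the smallest positive integer $t$ such that $F_{n+t}\equiv F_n \pmod p$ for all $n\ge 0$. For an odd prime $p$ and $j\in\{ -1,0,1\}$, let $\Lambda_j^p(a,b)=\{\xi\in\{0,1,\ldots,\pi_p(a,b)-1\} : (F_\xi/p)=j\}$. The prime $p$ is a $k$-PL prime ($k$-Pisano-Legendre prime) relative to $(a,b)$ if $k=|\Lambda_1^p(a,b)|-|\Lambda_{ -1}^p(a,b)|-|\Lambda_0^p(a,b)|$. The Pisano set $\chi(a,b)$ is the set of all integers $k$ for which there exists an odd prime $p$ that is a $k$-PL prime relative to $(a,b)$. Let $\Gamma$ be a simple connected graph of order $N$. A bijection $f:V(\Gamma)\to\{0,1,\ldots,N-1\}$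 is an $(a,b)$-FLC labeling (Fibonacci-Legendre cordial labeling) modulo $p$ if the induced edge labeling $f_p^*:E(\Gamma)\to\{0,1\}$, given by $f_p^*(uv)=\frac{1+([F_{f(u)}+F_{f(v)}]/p)}{2}$ if $F_{f(u)}+F_{f(v)}\not\equiv 0\pmod p$ and $f_p^*(uv)=0$ otherwise, satisfies $|e_{f_p^*}(0)-e_{f_p^*}(1)|\le 1$, where $e_{f_p^*}(i)$ is the number of edges labeled $i$. A graph admitting such a labeling is an $(a,b)$-FLC graph modulo $p$. If $G_1$ has order $n$, the corona graph $G_1\circ G_2$ is obtained by taking one copy of $G_1$ and $n$ disjoint copies of $G_2$, and joining the $i$th vertex of $G_1$ to every vertex of the $i$th copy of $G_2$. -}

module Defs where

open import Data.Fin as Fin using (Fin; toℕ)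
open import Data.Fin.Properties using (any?; inj⇒≟; +↔⊎; *↔×)
open import Data.Integer as ℤ using (ℤ; +_; 0ℤ; 1ℤ; -1ℤ; _+_; _-_; _*_; _/_)
open import Data.Integer.Divisibility.Signed using (_∣_; _∣?_)
open import Data.List using (List; length; filter; map; allFin; upTo; cartesianProduct)
open import Data.Nat as ℕ using (ℕ; zero; suc; NonZero)
open import Data.Nat.Primality using (Prime)
import Data.Nat.Divisibility as ℕ
import Data.Nat.Properties as ℕ
open import Data.Product using (_×_; _,_; ∃-syntax)
open import Data.Product.Function.NonDependent.Propositional using (_×-↔_)
open import Data.Sum using (_⊎_; inj₁; inj₂)
open import Data.Sum.Function.Propositional using (_⊎-↔_)
open import Function.Bundles using (_↔_; _⤖_; module Inverse; module Bijection)
open import Function.Construct.Composition using (_↔-∘_)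
open import Function.Properties.Inverse using (↔-sym; ↔⇒↣)
open import Relation.Binary using (Rel; Decidable; DecidableEquality; Symmetric; Irreflexive)
open import Relation.Binary.Construct.Closure.ReflexiveTransitive using (Star)
open import Relation.Binary.PropositionalEquality using (_≡_; refl; sym)
open import Relation.Nullary using (¬_; Dec; yes; no)
open import Relation.Nullary.Decidable using (_×-dec_)
open import Level using (0ℓ)

------------------------------------------------------------------------
-- Number theory

infix 4 _≡_[mod_]

_≡_[mod_] : ℤ → ℤ → ℕ → Set
x ≡ y [mod n ] = + n ∣ x - y

OddPrime : ℕ → Set
OddPrime p = Prime p × ¬ (2 ℕ.∣ p)

F : (a b : ℤ) → ℕ → ℤ
F a b zero          = a
F a b (suc zero)    = b
F a b (suc (suc n)) = F a b (suc n) + F a b n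

-- Square roots modulo p are sought among the representatives 0, …, p - 1,
-- which makes the notion decidable.
IsSquareMod : ℕ → ℤ → Set
IsSquareMod p x = ∃[ y ] + toℕ {p} y * + toℕ y ≡ x [mod p ]

isSquareMod? : ∀ p x → Dec (IsSquareMod p x)
isSquareMod? p x = any? λ y → + p ∣? (+ toℕ y * + toℕ y - x)

-- The Legendre symbol (x/p), meaningful when p is an odd prime.
legendre : ℤ → ℕ → ℤ
legendre x p with + p ∣? x
... | yes _ = 0ℤ
... | no  _ with isSquareMod? p x
...   | yes _ = 1ℤ
...   | no  _ = -1ℤ

IsPeriodMod : (p : ℕ) (a b : ℤ) → ℕ → Set
IsPeriodMod p a b t = ∀ n → F a b (n ℕ.+ t) ≡ F a b n [mod p ]

-- t = π_p(a,b)
record IsPisanoPeriod (p : ℕ) (a b : ℤ) (t : ℕ) : Set where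
  field
    positive : 0 ℕ.< t
    period   : IsPeriodMod p a b t
    least    : ∀ s → 0 ℕ.< s → IsPeriodMod p a b s → t ℕ.≤ s

-- Λ_j^p(a,b), as a repetition-free list, where t is the Pisano period.
Λ : (p : ℕ) (a b : ℤ) (t : ℕ) (j : ℤ) → List ℕ
Λ p a b t j = filter (λ ξ → legendre (F a b ξ) p ℤ.≟ j) (upTo t)

IsPL : (k : ℤ) (p : ℕ) (a b : ℤ) → Set
IsPL k p a b = ∃[ t ] IsPisanoPeriod p a b t ×
  k ≡ + length (Λ p a b t 1ℤ) - + length (Λ p a b t -1ℤ) - + length (Λ p a b t 0ℤ)

infix 4 _∈χ[_,_]

_∈χ[_,_] : ℤ → ℤ → ℤ → Set
k ∈χ[ a , b ] = ∃[ p ] OddPrime p × IsPL k p a b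

------------------------------------------------------------------------
-- Graphs

record Graph : Set₁ where
  infix 4 _~_ _~?_
  field
    V        : Set
    order    : ℕ
    enum     : Fin order ↔ V
    nonEmpty : NonZero order
    _~_      : Rel V 0ℓ
    _~?_     : Decidable _~_
    ~-sym    : Symmetric _~_
    ~-irrefl : Irreflexive _≡_ _~_

  vertex : Fin order → V
  vertex = Inverse.to enum

  _≟V_ : DecidableEquality V
  _≟V_ = inj⇒≟ (↔⇒↣ (↔-sym enum))

  -- Every edge is listed exactly once, its endpoint that comes first in the
  -- enumeration being put first.
  edges : List (V × V)
  edges = map (λ (i , j) → vertex i , vertex j)
    (filter (λ (i , j) → (i Fin.<? j) ×-dec (vertex i ~? vertex j))
      (cartesianProduct (allFin order) (allFin order)))

  size : ℕ
  size = length edges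

  Connected : Set
  Connected = ∀ u v → Star _~_ u v

------------------------------------------------------------------------
-- Corona

module _ (G H : Graph) where
  private
    module G = Graph G
    module H = Graph H

  -- inj₂ (g , h) is the vertex h in the copy of H attached to g.
  CoronaV : Set
  CoronaV = G.V ⊎ (G.V × H.V)

  CoronaAdj : Rel CoronaV 0ℓ
  CoronaAdj (inj₁ g)       (inj₁ g′)        = g G.~ g′
  CoronaAdj (inj₁ g)       (inj₂ (g′ , _))  = g ≡ g′
  CoronaAdj (inj₂ (g , _)) (inj₁ g′)        = g ≡ g′
  CoronaAdj (inj₂ (g , h)) (inj₂ (g′ , h′)) = g ≡ g′ × h H.~ h′

  coronaAdj? : Decidable CoronaAdj
  coronaAdj? (inj₁ g)       (inj₁ g′)        = g G.~? g′
  coronaAdj? (inj₁ g)       (inj₂ (g′ , _))  = g G.≟V g′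
  coronaAdj? (inj₂ (g , _)) (inj₁ g′)        = g G.≟V g′
  coronaAdj? (inj₂ (g , h)) (inj₂ (g′ , h′)) = (g G.≟V g′) ×-dec (h H.~? h′)

  coronaAdj-sym : Symmetric CoronaAdj
  coronaAdj-sym {inj₁ _} {inj₁ _} e       = G.~-sym e
  coronaAdj-sym {inj₁ _} {inj₂ _} e       = sym e
  coronaAdj-sym {inj₂ _} {inj₁ _} e       = sym e
  coronaAdj-sym {inj₂ _} {inj₂ _} (e , a) = sym e , H.~-sym a

  coronaAdj-irrefl : Irreflexive _≡_ CoronaAdj
  coronaAdj-irrefl {inj₁ _} refl a       = G.~-irrefl refl a
  coronaAdj-irrefl {inj₂ _} refl (_ , a) = H.~-irrefl refl a

  corona-nonEmpty : NonZero (G.order ℕ.+ G.order ℕ.* H.order)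
  corona-nonEmpty = ℕ.>-nonZero
    (ℕ.≤-trans (ℕ.>-nonZero⁻¹ G.order {{G.nonEmpty}}) (ℕ.m≤m+n G.order _))

infixl 7 _∘ᶜ_

_∘ᶜ_ : Graph → Graph → Graph
G ∘ᶜ H = record
  { V        = CoronaV G H
  ; order    = G.order ℕ.+ G.order ℕ.* H.order
  ; enum     = (G.enum ⊎-↔ ((G.enum ×-↔ H.enum) ↔-∘ *↔×)) ↔-∘ +↔⊎
  ; nonEmpty = corona-nonEmpty G H
  ; _~_      = CoronaAdj G H
  ; _~?_     = coronaAdj? G H
  ; ~-sym    = λ {x} {y} → coronaAdj-sym G H {x} {y}
  ; ~-irrefl = coronaAdj-irrefl G H
  }
  where
  module G = Graph G
  module H = Graph H

------------------------------------------------------------------------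
-- Fibonacci-Legendre cordial labelings

-- The label of an edge whose endpoints carry Fibonacci numbers with sum s.
edgeLabel : ℕ → ℤ → ℤ
edgeLabel p s with + p ∣? s
... | yes _ = 0ℤ
... | no  _ = (1ℤ + legendre s p) / + 2

module _ (p : ℕ) (a b : ℤ) (Γ : Graph) where
  open Graph Γ

  inducedLabel : V ⤖ Fin order → V × V → ℤ
  inducedLabel f (u , v) = edgeLabel p (Fib u + Fib v)
    where
    Fib : V → ℤ
    Fib w = F a b (toℕ (Bijection.to f w))

  edgeCount : V ⤖ Fin order → ℤ → ℕ
  edgeCount f i = length (filter (λ e → inducedLabel f e ℤ.≟ i) edges)

  IsFLCLabeling : V ⤖ Fin order → Set
  IsFLCLabeling f = ℕ.∣ edgeCount f 0ℤ - edgeCount f 1ℤ ∣ ℕ.≤ 1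

  -- FLC labelings are only considered on connected graphs.
  IsFLC : Set
  IsFLC = Connected × ∃[ f ] IsFLCLabeling f

{-# OPTIONS --safe #-}
module Submission where

-- Give the vertices of G the labels divisible by π, and the vertices of the copy of H attached to the
-- i-th vertex of G (0 ≤ i < π - 1) the labels congruent to i + 1 modulo π. Then every edge of G has the sum 0
-- modulo p, a spoke to the i-th copy has the sum F_{i+1}, and an edge inside that copy has the sum 2F_{i+1}.
-- As 2 is a square modulo p (or H has no edge), the m + π - 1 edges of the i-th copy and its spokes all have
-- the label of F_{i+1}, and k + 1 is exactly the excess of the indices with label 1 over those with label 0.
--
-- That 2 is a square when p ≡ ±1 modulo 8: put p = 2h + 1. Gauss's computation of 2·4·…·2h gives 2^h ≡ 1.
-- If 2 were not a square, pairing every unit x with 2/x would give (p-1)! ≡ 2^h, against Wilson's theorem.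

open import Defs
open import Data.Bool using (if_then_else_)
open import Data.Fin as Fin using (Fin; toℕ; fromℕ<; _↑ˡ_; _↑ʳ_; combine)
open import Data.Fin.Properties using (toℕ-fromℕ<; toℕ<n; toℕ-↑ˡ; toℕ-↑ʳ; toℕ-combine; toℕ-cast; splitAt-↑ˡ; splitAt-↑ʳ; remQuot-combine; combine-injective; combine-surjective; cast-involutive; suc-injective)
open import Data.Integer using (ℤ; +_; 0ℤ; 1ℤ; -1ℤ; _+_; _-_; _*_; _/_; _^_; _≤_; -_; ∣_∣)
open import Data.Integer.Divisibility.Signed using (_∣_; _∣?_; divides; ∣⇒∣ᵤ; ∣ᵤ⇒∣; ∣m⇒∣-m; ∣m∣n⇒∣m+n; ∣m⇒∣m*n; ∣n⇒∣m*n)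
open import Data.Integer.DivMod using (_%ℕ_; _/ℕ_; a≡a%ℕn+[a/ℕn]*n; n%ℕd<d)
import Data.Integer.Properties as ℤ
open import Data.Integer.Tactic.RingSolver using (solve-∀)
open import Data.List using (List; []; _∷_; _++_; length; filter; map; tabulate; applyUpTo; allFin; cartesianProduct)
open import Data.List.Membership.Propositional using (_∈_)
open import Data.List.Membership.Propositional.Properties using (∈-∃++; ∈-applyUpTo⁺; ∈-applyUpTo⁻)
open import Data.List.Properties using (length-++; filter-++; map-tabulate; length-applyUpTo; applyUpTo-∷ʳ)
open import Data.List.Relation.Binary.Permutation.Propositional using (_↭_; ↭-sym; prep; ↭⇒↭ₛ)
open import Data.List.Relation.Binary.Permutation.Propositional.Properties using (shift; ∈-resp-↭; ↭-length)
import Data.List.Relation.Binary.Permutation.Setoid.Properties as Permutation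
open import Data.List.Relation.Unary.All as All using (_∷_)
open import Data.List.Relation.Unary.AllPairs using (_∷_)
open import Data.List.Relation.Unary.Any using (here; there)
open import Data.List.Relation.Unary.Unique.Propositional using (Unique)
open import Data.List.Relation.Unary.Unique.Propositional.Properties using (applyUpTo⁺₁)
open import Data.Nat as ℕ using (ℕ; zero; suc; _∸_; _!; s≤s; z≤n)
open import Data.Nat.Coprimality using (prime⇒coprime; coprime-Bézout)
import Data.Nat.Divisibility as ℕ
open import Data.Nat.GCD using (module Bézout)
open import Data.Nat.Induction using (Acc; acc; <-wellFounded)
open import Data.Nat.ListAction using (product)
open import Data.Nat.ListAction.Properties using (product-↭; product-++)
open import Data.Nat.Primality using (Prime; euclidsLemma; prime⇒nonTrivial; prime⇒nonZero)
import Data.Nat.Properties as ℕ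
open import Data.Nat.Tactic.RingSolver renaming (solve-∀ to solveℕ-∀) using ()
open import Data.Product using (_×_; _,_; ∃-syntax; proj₁; proj₂; map₁; map₂)
open import Data.Sum as Sum using (_⊎_; inj₁; inj₂)
open import Function using (_∘_; _⤖_; mk⤖)
open import Function.Bundles using (module Bijection; module Injection; module Inverse)
open import Function.Consequences.Propositional using (strictlySurjective⇒surjective)
open import Function.Properties.Inverse using (↔⇒↣)
open import Level using (0ℓ)
open import Relation.Binary using (Setoid)
open import Relation.Binary.Construct.Closure.ReflexiveTransitive as Path using (Star; _◅_; _◅◅_; gmap)
open import Relation.Binary.PropositionalEquality using (_≡_; _≢_; refl; sym; trans; cong; cong₂; subst; subst₂; setoid; module ≡-Reasoning)
open import Relation.Nullary using (¬_; Dec; yes; no; does; contradiction)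
open import Relation.Nullary.Decidable using (_×-dec_; decidable-stable)
open import Relation.Unary using (Pred; Decidable)
open import Algebra.Properties.Semiring.Sum ℕ.+-*-semiring using (sum; sum-syntax; sum-cong-≗; sum-replicate-zero; ∑-distrib-+; *-distribˡ-sum)

-- Congruence modulo p

module Congruence (p : ℕ) where

  infix 4 _≈_

  -- A record, so that both sides can be inferred from a proof.
  record _≈_ (x y : ℤ) : Set where
    constructor mk
    field difference : x ≡ y [mod p ]
  open _≈_ public

  private
    cast : ∀ {x y} → x ≡ y → + p ∣ x → + p ∣ y
    cast = subst (+ p ∣_)

  ≈-refl : ∀ {x} → x ≈ x
  ≈-refl {x} = mk (divides 0ℤ (ℤ.+-inverseʳ x))

  ≈-sym : ∀ {x y} → x ≈ y → y ≈ x
  ≈-sym {x} {y} (mk d) = mk (cast (lem x y) (∣m⇒∣-m d))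
    where
    lem : ∀ x y → - (x - y) ≡ y - x
    lem = solve-∀

  ≈-trans : ∀ {x y z} → x ≈ y → y ≈ z → x ≈ z
  ≈-trans {x} {y} {z} (mk d) (mk e) = mk (cast (lem x y z) (∣m∣n⇒∣m+n d e))
    where
    lem : ∀ x y z → x - y + (y - z) ≡ x - z
    lem = solve-∀

  ≈-reflexive : ∀ {x y} → x ≡ y → x ≈ y
  ≈-reflexive refl = ≈-refl

  ≈-setoid : Setoid _ _
  ≈-setoid = record
    { Carrier = ℤ ; _≈_ = _≈_
    ; isEquivalence = record { refl = ≈-refl ; sym = ≈-sym ; trans = ≈-trans } }

  +-cong : ∀ {x x′ y y′} → x ≈ x′ → y ≈ y′ → x + y ≈ x′ + y′
  +-cong {x} {x′} {y} {y′} (mk d) (mk e) = mk (cast (lem x x′ y y′) (∣m∣n⇒∣m+n d e))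
    where
    lem : ∀ x x′ y y′ → x - x′ + (y - y′) ≡ x + y - (x′ + y′)
    lem = solve-∀

  *-cong : ∀ {x x′ y y′} → x ≈ x′ → y ≈ y′ → x * y ≈ x′ * y′
  *-cong {x} {x′} {y} {y′} (mk d) (mk e) =
    mk (cast (lem x x′ y y′) (∣m∣n⇒∣m+n (∣n⇒∣m*n x e) (∣m⇒∣m*n y′ d)))
    where
    lem : ∀ x x′ y y′ → x * (y - y′) + (x - x′) * y′ ≡ x * y - x′ * y′
    lem = solve-∀

  *-congˡ : ∀ x {y y′} → y ≈ y′ → x * y ≈ x * y′
  *-congˡ x = *-cong (≈-refl {x})

  *-congʳ : ∀ {x x′} y → x ≈ x′ → x * y ≈ x′ * y
  *-congʳ y e = *-cong e (≈-refl {y})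

  p≈0 : + p ≈ 0ℤ
  p≈0 = mk (divides 1ℤ (trans (ℤ.+-identityʳ (+ p)) (sym (ℤ.*-identityˡ (+ p)))))

  ∣⇒≈0 : ∀ {x} → + p ∣ x → x ≈ 0ℤ
  ∣⇒≈0 {x} d = mk (cast (sym (ℤ.+-identityʳ x)) d)

  ≈0⇒∣ : ∀ {x} → x ≈ 0ℤ → + p ∣ x
  ≈0⇒∣ {x} (mk d) = cast (ℤ.+-identityʳ x) d

  ∣-resp-≈ : ∀ {x y} → x ≈ y → + p ∣ x → + p ∣ y
  ∣-resp-≈ e d = ≈0⇒∣ (≈-trans (≈-sym e) (∣⇒≈0 d))

  private
    -- A nonzero difference `y ∸ x` would be a positive multiple of `p`, hence at least `p`,
    -- although it is at most `y`.
    ≤-≈⇒≡ : ∀ {x y} → x ℕ.≤ y → y ℕ.< p → + y ≈ + x → y ≡ x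
    ≤-≈⇒≡ {x} {y} x≤y y<p (mk d) with y ∸ x in eq
    ... | zero  = ℕ.≤-antisym (ℕ.m∸n≡0⇒m≤n eq) x≤y
    ... | suc k = contradiction
      (ℕ.∣⇒≤ (subst (p ℕ.∣_) (trans (cong ∣_∣ (trans (ℤ.m-n≡m⊖n y x) (ℤ.⊖-≥ x≤y))) eq) (∣⇒∣ᵤ d)))
      (ℕ.<⇒≱ (ℕ.≤-<-trans (ℕ.≤-trans (ℕ.≤-reflexive (sym eq)) (ℕ.m∸n≤m y x)) y<p))

  ≈⇒≡ : ∀ {x y} → x ℕ.< p → y ℕ.< p → + x ≈ + y → x ≡ y
  ≈⇒≡ {x} {y} x<p y<p e with ℕ.≤-total x y
  ... | inj₁ x≤y = sym (≤-≈⇒≡ x≤y y<p (≈-sym e))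
  ... | inj₂ y≤x = ≤-≈⇒≡ y≤x x<p e

  %ℕ-≈ : .{{_ : ℕ.NonZero p}} → ∀ y → + (y %ℕ p) ≈ y
  %ℕ-≈ y = ≈-sym (mk (divides (y /ℕ p) (begin
    y - + (y %ℕ p)                             ≡⟨ cong (_- + (y %ℕ p)) (a≡a%ℕn+[a/ℕn]*n y p) ⟩
    + (y %ℕ p) + y /ℕ p * + p - + (y %ℕ p)     ≡⟨ lem (+ (y %ℕ p)) _ ⟩
    y /ℕ p * + p                               ∎)))
    where
    open ≡-Reasoning
    lem : ∀ x y → x + y - x ≡ y
    lem = solve-∀

  -- `IsSquareMod` asks for a root among 0, ..., p - 1, so an arbitrary integer root is replaced by
  -- its remainder.
  isSquareMod : .{{_ : ℕ.NonZero p}} → ∀ {x} y → y * y ≈ x → IsSquareMod p x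
  isSquareMod y yy≈x = fromℕ< (n%ℕd<d y p) , difference (≈-trans (*-cong r≈y r≈y) yy≈x)
    where
    r≈y : + toℕ (fromℕ< (n%ℕd<d y p)) ≈ y
    r≈y = ≈-trans (≈-reflexive (cong +_ (toℕ-fromℕ< (n%ℕd<d y p)))) (%ℕ-≈ y)

  -- The list is consumed two elements at a time, an element together with its partner.
  abstract
    product-of-pairs : ∀ {c} (xs : List ℕ) → Unique xs →
      (∀ {x} → x ∈ xs → ∃[ y ] y ∈ xs × x ≢ y × + x * + y ≈ c) →
      (∀ {x y z} → x ∈ xs → y ∈ xs → z ∈ xs → + x * + y ≈ c → + x * + z ≈ c → y ≡ z) →
      ∃[ j ] length xs ≡ j ℕ.+ j × + product xs ≈ c ^ j
    product-of-pairs {c} xs = go xs (<-wellFounded _)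
      where
      *-comm-≈ : ∀ x y → + x * + y ≈ c → + y * + x ≈ c
      *-comm-≈ x y = ≈-trans (≈-reflexive (ℤ.*-comm (+ y) (+ x)))

      -- The recursive call is on `ys ++ zs`, with the partner cut out of the middle. This is no
      -- structural subterm, so the recursion is on the length.
      go : ∀ xs → Acc ℕ._<_ (length xs) → Unique xs →
        (∀ {x} → x ∈ xs → ∃[ y ] y ∈ xs × x ≢ y × + x * + y ≈ c) →
        (∀ {x y z} → x ∈ xs → y ∈ xs → z ∈ xs → + x * + y ≈ c → + x * + z ≈ c → y ≡ z) →
        ∃[ j ] length xs ≡ j ℕ.+ j × + product xs ≈ c ^ j
      go [] _ _ _ _ = 0 , refl , ≈-refl
      go (x ∷ xs) (acc rec) u partner unique with partner (here refl)
      ... | y , here refl , x≢y , _ = contradiction refl x≢y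
      ... | y , there y∈xs , x≢y , xy≈c with ∈-∃++ y∈xs
      ... | ys , zs , refl = suc j
        , trans (↭-length perm) (cong suc (trans (cong suc len) (sym (ℕ.+-suc j j))))
        , ≈-trans (≈-reflexive (trans (cong +_ (product-↭ perm)) (lem₁ x y (product ws))))
                  (*-cong xy≈c prod)
        where
        ws : List ℕ
        ws = ys ++ zs
        perm : x ∷ ys ++ y ∷ zs ↭ x ∷ y ∷ ws
        perm = prep x (shift y ys zs)
        into : ∀ {z} → z ∈ x ∷ ys ++ y ∷ zs → z ∈ x ∷ y ∷ ws
        into = ∈-resp-↭ perm
        back : ∀ {z} → z ∈ x ∷ y ∷ ws → z ∈ x ∷ ys ++ y ∷ zs
        back = ∈-resp-↭ (↭-sym perm)
        lem₁ : ∀ a b q → + (a ℕ.* (b ℕ.* q)) ≡ + a * + b * + q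
        lem₁ a b q = trans (ℤ.pos-* a _) (trans (cong (+ a *_) (ℤ.pos-* b q)) (sym (ℤ.*-assoc (+ a) (+ b) (+ q))))
        u′ : Unique (x ∷ y ∷ ws)
        u′ = Permutation.Unique-resp-↭ (setoid ℕ) (↭⇒↭ₛ perm) u
        -- The partner of `z` stays in `ws`. If it were `x`, then `x` would have the partners `y`
        -- and `z`, forcing `z ≡ y`; if it were `y`, then likewise `z ≡ x`. Neither `x` nor `y`
        -- occurs in `ws`.
        partner′ : ∀ {z} → z ∈ ws → ∃[ w ] w ∈ ws × z ≢ w × + z * + w ≈ c
        partner′ {z} z∈ws with partner (back (there (there z∈ws)))
        ... | w , w∈ , z≢w , zw≈c with u′ | into w∈
        ... | _ ∷ y∉ws ∷ _ | here refl = contradiction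
          (unique (here refl) (there y∈xs) (back (there (there z∈ws))) xy≈c (*-comm-≈ z w zw≈c))
          (All.lookup y∉ws z∈ws)
        ... | (_ ∷ x∉ws) ∷ _ | there (here refl) = contradiction
          (unique w∈ (here refl) (back (there (there z∈ws))) (*-comm-≈ x y xy≈c) (*-comm-≈ z w zw≈c))
          (All.lookup x∉ws z∈ws)
        ... | _ | there (there w∈ws) = w , w∈ws , z≢w , zw≈c
        uws : Unique ws
        uws with _ ∷ _ ∷ v ← u′ = v
        shorter : length ws ℕ.< length (x ∷ ys ++ y ∷ zs)
        shorter = subst (length ws ℕ.<_) (sym (↭-length perm)) (ℕ.m<n⇒m<1+n (ℕ.n<1+n _))
        rest : ∃[ j ] length ws ≡ j ℕ.+ j × + product ws ≈ c ^ j
        rest = go ws (rec shorter) uws partner′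
          (λ a b d → unique (back (there (there a))) (back (there (there b))) (back (there (there d))))
        j : ℕ
        j = proj₁ rest
        len : length ws ≡ j ℕ.+ j
        len = proj₁ (proj₂ rest)
        prod : + product ws ≈ c ^ j
        prod = proj₂ (proj₂ rest)

-- Factorials split into even and odd factors

oddProduct : ℕ → ℕ
oddProduct zero    = 1
oddProduct (suc d) = suc (d ℕ.+ d) ℕ.* oddProduct d

mutual
  -- The even factors 2, 4, ..., 2r contribute 2^r r!, and the odd factors 1, 3, ..., 2r - 1
  -- contribute the double factorial `oddProduct r`. The two lemmas alternate because each step adds
  -- a single factor.
  factorial-even : ∀ r → 2 ℕ.^ r ℕ.* r ! ℕ.* oddProduct r ≡ (r ℕ.+ r) !
  factorial-even zero    = refl
  factorial-even (suc r) = begin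
    2 ℕ.^ suc r ℕ.* suc r ! ℕ.* oddProduct (suc r)                   ≡⟨ lem (2 ℕ.^ r) r (r !) (oddProduct (suc r)) ⟩
    suc (suc (r ℕ.+ r)) ℕ.* (2 ℕ.^ r ℕ.* r ! ℕ.* oddProduct (suc r)) ≡⟨ cong (suc (suc (r ℕ.+ r)) ℕ.*_) (factorial-odd r) ⟩
    suc (suc (r ℕ.+ r)) !                                            ≡⟨ cong (λ n → suc n !) (sym (ℕ.+-suc r r)) ⟩
    (suc r ℕ.+ suc r) !                                              ∎
    where
    open ≡-Reasoning
    lem : ∀ a r b o → 2 ℕ.* a ℕ.* (suc r ℕ.* b) ℕ.* o ≡ suc (suc (r ℕ.+ r)) ℕ.* (a ℕ.* b ℕ.* o)
    lem = solveℕ-∀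

  factorial-odd : ∀ r → 2 ℕ.^ r ℕ.* r ! ℕ.* oddProduct (suc r) ≡ suc (r ℕ.+ r) !
  factorial-odd r = trans (lem (2 ℕ.^ r ℕ.* r !) (suc (r ℕ.+ r)) (oddProduct r))
    (cong (suc (r ℕ.+ r) ℕ.*_) (factorial-even r))
    where
    lem : ∀ a b o → a ℕ.* (b ℕ.* o) ≡ b ℕ.* (a ℕ.* o)
    lem = solveℕ-∀

-- For p = r + 3 this separates 1 and p - 1, the two units that are their own inverses, from the
-- numbers 2, ..., p - 2 that can be paired.
product-range : ∀ r → product (applyUpTo suc (2 ℕ.+ r)) ≡ product (applyUpTo (2 ℕ.+_) r) ℕ.* (2 ℕ.+ r)
product-range r = begin
  product (applyUpTo suc (2 ℕ.+ r))        ≡⟨ cong (λ xs → product (1 ∷ xs)) (applyUpTo-∷ʳ (2 ℕ.+_) r) ⟨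
  product (1 ∷ middle ++ (2 ℕ.+ r) ∷ [])   ≡⟨ ℕ.*-identityˡ (product (middle ++ (2 ℕ.+ r) ∷ [])) ⟩
  product (middle ++ (2 ℕ.+ r) ∷ [])       ≡⟨ product-++ middle ((2 ℕ.+ r) ∷ []) ⟩
  product middle ℕ.* product ((2 ℕ.+ r) ∷ []) ≡⟨ cong (product middle ℕ.*_) (ℕ.*-identityʳ (2 ℕ.+ r)) ⟩
  product middle ℕ.* (2 ℕ.+ r)             ∎
  where
  open ≡-Reasoning
  middle = applyUpTo (2 ℕ.+_) r

-- Division modulo a prime and Gauss's computation

module PrimeModulus (p : ℕ) (p-prime : Prime p) where

  open Congruence p public
  open import Relation.Binary.Reasoning.Setoid ≈-setoid

  private instance _ = prime⇒nonZero p-prime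

  euclid : ∀ x y → + p ∣ x * y → (+ p ∣ x) ⊎ (+ p ∣ y)
  euclid x y d = Sum.map ∣ᵤ⇒∣ ∣ᵤ⇒∣
    (euclidsLemma ∣ x ∣ ∣ y ∣ p-prime (subst (p ℕ.∣_) (ℤ.abs-* x y) (∣⇒∣ᵤ d)))

  *-cancelˡ-≈ : ∀ {a x y} → ¬ + p ∣ a → a * x ≈ a * y → x ≈ y
  *-cancelˡ-≈ {a} {x} {y} p∤a e = mk (Sum.[ (λ d → contradiction d p∤a) , (λ d → d) ]′
    (euclid a (x - y) (subst (+ p ∣_) (lem a x y) (difference e))))
    where
    lem : ∀ a x y → a * x - a * y ≡ a * (x - y)
    lem = solve-∀

  p∤ : ∀ {x} → .{{ℕ.NonZero x}} → x ℕ.< p → ¬ + p ∣ + x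
  p∤ x<p d = ℕ.<⇒≱ x<p (ℕ.∣⇒≤ (∣⇒∣ᵤ d))

  -- By Euclid's lemma `p` would divide a factor, and all factors are positive and below `p`. This
  -- allows `2^h≈1` to cancel `h !`.
  p∤! : ∀ n → n ℕ.< p → ¬ + p ∣ + (n !)
  p∤! zero    1<p d = p∤ (ℕ.nonTrivial⇒n>1 p {{prime⇒nonTrivial p-prime}}) d
  p∤! (suc n) n<p d with euclid (+ suc n) (+ (n !)) (subst (+ p ∣_) (ℤ.pos-* (suc n) (n !)) d)
  ... | inj₁ e = p∤ n<p e
  ... | inj₂ e = p∤! n (ℕ.<-trans (ℕ.n<1+n n) n<p) e

  inverse : ∀ x .{{_ : ℕ.NonZero x}} → x ℕ.< p → ∃[ y ] + x * y ≈ 1ℤ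
  inverse x x<p with coprime-Bézout (prime⇒coprime p-prime x<p)
  -- Over the natural numbers Bézout's identity has two forms. Here it reads 1 + vx = up, so x(-v) =
  -- 1 - up; in the other case it reads 1 + up = vx and `v` itself is the inverse.
  ... | Bézout.+- u v eq = - + v , (begin
    + x * - + v           ≡⟨ lem₁ (+ x) (+ v) ⟩
    1ℤ - (1ℤ + + v * + x) ≡⟨ cong (λ z → 1ℤ - (1ℤ + z)) (sym (ℤ.pos-* v x)) ⟩
    1ℤ - + (1 ℕ.+ v ℕ.* x) ≡⟨ cong (λ z → 1ℤ - + z) eq ⟩
    1ℤ - + (u ℕ.* p)      ≡⟨ cong (λ z → 1ℤ - z) (ℤ.pos-* u p) ⟩
    1ℤ - + u * + p        ≡⟨ lem₂ (+ u) (+ p) ⟩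
    1ℤ + - + u * + p      ≈⟨ +-cong (≈-refl {1ℤ}) (*-congˡ (- + u) p≈0) ⟩
    1ℤ + - + u * 0ℤ       ≡⟨ cong (λ z → 1ℤ + z) (ℤ.*-zeroʳ (- + u)) ⟩
    1ℤ                    ∎)
    where
    lem₁ : ∀ x v → x * - v ≡ 1ℤ - (1ℤ + v * x)
    lem₁ = solve-∀
    lem₂ : ∀ u p → 1ℤ - u * p ≡ 1ℤ + - u * p
    lem₂ = solve-∀
  ... | Bézout.-+ u v eq = + v , (begin
    + x * + v        ≡⟨ ℤ.*-comm (+ x) (+ v) ⟩
    + v * + x        ≡⟨ ℤ.pos-* v x ⟨
    + (v ℕ.* x)      ≡⟨ cong +_ eq ⟨
    1ℤ + + (u ℕ.* p) ≡⟨ cong (λ z → 1ℤ + z) (ℤ.pos-* u p) ⟩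
    1ℤ + + u * + p   ≈⟨ +-cong (≈-refl {1ℤ}) (*-congˡ (+ u) p≈0) ⟩
    1ℤ + + u * 0ℤ    ≡⟨ cong (λ z → 1ℤ + z) (ℤ.*-zeroʳ (+ u)) ⟩
    1ℤ               ∎)

  abstract
    division : ∀ c x .{{_ : ℕ.NonZero x}} → x ℕ.< p → ∃[ y ] y ℕ.< p × + x * + y ≈ c
    division c x x<p with y , xy≈1 ← inverse x x<p = (y * c) %ℕ p , n%ℕd<d (y * c) p , (begin
      + x * + ((y * c) %ℕ p) ≈⟨ *-congˡ (+ x) (%ℕ-≈ (y * c)) ⟩
      + x * (y * c)          ≡⟨ ℤ.*-assoc (+ x) y c ⟨
      + x * y * c            ≈⟨ *-congʳ c xy≈1 ⟩
      1ℤ * c                 ≡⟨ ℤ.*-identityˡ c ⟩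
      c                      ∎)

  division-unique : ∀ {x y z c} .{{_ : ℕ.NonZero x}} → x ℕ.< p → y ℕ.< p → z ℕ.< p →
    + x * + y ≈ c → + x * + z ≈ c → y ≡ z
  division-unique x<p y<p z<p e e′ =
    ≈⇒≡ y<p z<p (*-cancelˡ-≈ (p∤ x<p) (≈-trans e (≈-sym e′)))

  -- The even numbers 2h, 2(h-1), …, reduced modulo p = 2h + 1, are -1, -3, ….
  gauss : ∀ h → p ≡ suc (h ℕ.+ h) → ∀ d r → r ℕ.+ d ≡ h →
    (+ 2) ^ d * + (h !) ≈ -1ℤ ^ d * + oddProduct d * + (r !)
  gauss h eq zero    r r+d≡h = ≈-reflexive (cong (λ n → 1ℤ * + (n !)) (trans (sym r+d≡h) (ℕ.+-identityʳ r)))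
  gauss h eq (suc d) r r+d≡h = begin
    + 2 * (+ 2) ^ d * + (h !)
      ≡⟨ ℤ.*-assoc (+ 2) ((+ 2) ^ d) (+ (h !)) ⟩
    + 2 * ((+ 2) ^ d * + (h !))
      ≈⟨ *-congˡ (+ 2) (gauss h eq d (suc r) (trans (sym (ℕ.+-suc r d)) r+d≡h)) ⟩
    + 2 * (-1ℤ ^ d * + oddProduct d * + (suc r !))
      ≡⟨ cong (λ z → + 2 * (-1ℤ ^ d * + oddProduct d * z)) (ℤ.pos-* (suc r) (r !)) ⟩
    + 2 * (-1ℤ ^ d * + oddProduct d * ((1ℤ + + r) * + (r !)))
      ≡⟨ lem₁ (-1ℤ ^ d) (+ oddProduct d) (+ r) (+ (r !)) ⟩
    (+ 2 * (1ℤ + + r)) * (-1ℤ ^ d * + oddProduct d * + (r !))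
      ≈⟨ *-congʳ (-1ℤ ^ d * + oddProduct d * + (r !)) complement ⟩
    - (1ℤ + + (d ℕ.+ d)) * (-1ℤ ^ d * + oddProduct d * + (r !))
      ≡⟨ lem₂ (-1ℤ ^ d) (+ oddProduct d) (1ℤ + + (d ℕ.+ d)) (+ (r !)) ⟩
    -1ℤ * -1ℤ ^ d * ((1ℤ + + (d ℕ.+ d)) * + oddProduct d) * + (r !)
      ≡⟨ cong (λ z → -1ℤ * -1ℤ ^ d * z * + (r !)) (ℤ.pos-* (suc (d ℕ.+ d)) (oddProduct d)) ⟨
    -1ℤ * -1ℤ ^ d * + oddProduct (suc d) * + (r !)                  ∎
    where
    lem₁ : ∀ s o r f → + 2 * (s * o * ((1ℤ + r) * f)) ≡ (+ 2 * (1ℤ + r)) * (s * o * f)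
    lem₁ = solve-∀
    lem₂ : ∀ s o d f → - d * (s * o * f) ≡ -1ℤ * s * (d * o) * f
    lem₂ = solve-∀
    lem₃ : ∀ r d → + 2 * (1ℤ + r) ≡ (1ℤ + (r + (1ℤ + d) + (r + (1ℤ + d)))) + - (1ℤ + (d + d))
    lem₃ = solve-∀
    p≡ : 1ℤ + (+ r + (1ℤ + + d) + (+ r + (1ℤ + + d))) ≡ + p
    p≡ = trans (cong (λ n → + suc (n ℕ.+ n)) r+d≡h) (cong +_ (sym eq))
    -- Since h = r + d + 1 and p = 2h + 1, the even number 2(r + 1) equals p - (2d + 1).
    complement : + 2 * (1ℤ + + r) ≈ - (1ℤ + + (d ℕ.+ d))
    complement = begin
      + 2 * (1ℤ + + r) ≡⟨ lem₃ (+ r) (+ d) ⟩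
      _                ≡⟨ cong (_+ - (1ℤ + + (d ℕ.+ d))) p≡ ⟩
      + p + - (1ℤ + + (d ℕ.+ d)) ≈⟨ +-cong p≈0 (≈-refl { - (1ℤ + + (d ℕ.+ d))}) ⟩
      0ℤ + - (1ℤ + + (d ℕ.+ d))  ≡⟨ ℤ.+-identityˡ _ ⟩
      - (1ℤ + + (d ℕ.+ d)) ∎

  pos-^ : ∀ r → + (2 ℕ.^ r) ≡ (+ 2) ^ r
  pos-^ zero    = refl
  pos-^ (suc r) = trans (ℤ.pos-* 2 (2 ℕ.^ r)) (cong (+ 2 *_) (pos-^ r))

  -- The cases h = 4e and h + 1 = 4e are p = 8e + 1 and p = 8e - 1. `gauss` is applied to the top d
  -- = 2e factors of h!, so its sign is 1. The remaining r = h - d factors are d or d - 1 in number,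
  -- and they keep their powers of 2: the result 2^r r! 1·3·...·(2d - 1) is h! again. Hence 2^h h! ≡
  -- h!, and h! cancels.
  2^h≈1 : ∀ h e → p ≡ suc (h ℕ.+ h) →
    h ≡ e ℕ.+ e ℕ.+ (e ℕ.+ e) ⊎ suc h ≡ e ℕ.+ e ℕ.+ (e ℕ.+ e) → (+ 2) ^ h ≈ 1ℤ
  2^h≈1 h e p≡ h-cases = *-cancelˡ-≈ (p∤! h h<p) (begin
    + (h !) * (+ 2) ^ h
      ≡⟨ cong (+ (h !) *_) (trans (cong ((+ 2) ^_) (sym (proj₁ (proj₂ split)))) (ℤ.^-distribˡ-+-* (+ 2) r d)) ⟩
    + (h !) * ((+ 2) ^ r * (+ 2) ^ d)
      ≡⟨ lem₁ (+ (h !)) ((+ 2) ^ r) ((+ 2) ^ d) ⟩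
    (+ 2) ^ r * ((+ 2) ^ d * + (h !))
      ≈⟨ *-congˡ ((+ 2) ^ r) (gauss h p≡ d r (proj₁ (proj₂ split))) ⟩
    (+ 2) ^ r * (-1ℤ ^ d * + oddProduct d * + (r !))
      ≡⟨ cong (λ z → (+ 2) ^ r * (z * + oddProduct d * + (r !))) sign ⟩
    (+ 2) ^ r * (1ℤ * + oddProduct d * + (r !))
      ≡⟨ lem₂ ((+ 2) ^ r) (+ oddProduct d) (+ (r !)) ⟩
    (+ 2) ^ r * + (r !) * + oddProduct d
      ≡⟨ cong (λ z → z * + (r !) * + oddProduct d) (pos-^ r) ⟨
    + (2 ℕ.^ r) * + (r !) * + oddProduct d
      ≡⟨ cong (_* + oddProduct d) (ℤ.pos-* (2 ℕ.^ r) (r !)) ⟨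
    + (2 ℕ.^ r ℕ.* r !) * + oddProduct d
      ≡⟨ ℤ.pos-* (2 ℕ.^ r ℕ.* r !) (oddProduct d) ⟨
    + (2 ℕ.^ r ℕ.* r ! ℕ.* oddProduct d)
      ≡⟨ cong +_ (proj₂ (proj₂ split)) ⟩
    + (h !)
      ≡⟨ ℤ.*-identityʳ (+ (h !)) ⟨
    + (h !) * 1ℤ      ∎)
    where
    d = e ℕ.+ e
    h<p : h ℕ.< p
    h<p = subst (h ℕ.<_) (sym p≡) (s≤s (ℕ.m≤m+n h h))
    splitting : h ≡ d ℕ.+ d ⊎ suc h ≡ d ℕ.+ d → ∃[ r ] r ℕ.+ d ≡ h × 2 ℕ.^ r ℕ.* r ! ℕ.* oddProduct d ≡ h !
    splitting (inj₁ eq) = d , sym eq , trans (factorial-even d) (cong _! (sym eq))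
    splitting (inj₂ eq) with d
    ... | suc r = r , ℕ.suc-injective (sym eq)
      , trans (factorial-odd r) (cong _! (trans (sym (ℕ.+-suc r r)) (ℕ.suc-injective (sym eq))))
    split = splitting h-cases
    r = proj₁ split
    lem₁ : ∀ a b c → a * (b * c) ≡ b * (c * a)
    lem₁ = solve-∀
    lem₂ : ∀ a b c → a * (1ℤ * b * c) ≡ a * c * b
    lem₂ = solve-∀
    sign : -1ℤ ^ d ≡ 1ℤ
    sign = trans (cong (-1ℤ ^_) (cong (e ℕ.+_) (sym (ℕ.+-identityʳ e)))) (trans (sym (ℤ.^-*-assoc -1ℤ 2 e)) (ℤ.^-zeroˡ e))

  -- Pairing the units: Wilson's theorem and squareness of 2

  private
    ∈-applyUpTo-from : ∀ a n {x} → x ∈ applyUpTo (a ℕ.+_) n → a ℕ.≤ x × x ℕ.< a ℕ.+ n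
    ∈-applyUpTo-from a n x∈ with i , i<n , refl ← ∈-applyUpTo⁻ (a ℕ.+_) x∈ = ℕ.m≤m+n a i , ℕ.+-monoʳ-< a i<n

    from-∈-applyUpTo : ∀ a n {x} → a ℕ.≤ x → x ℕ.< a ℕ.+ n → x ∈ applyUpTo (a ℕ.+_) n
    from-∈-applyUpTo a n {x} a≤x x<a+n = subst (_∈ applyUpTo (a ℕ.+_) n) (ℕ.m+[n∸m]≡n a≤x)
      (∈-applyUpTo⁺ (a ℕ.+_) (ℕ.+-cancelˡ-< a _ n (subst (ℕ._< a ℕ.+ n) (sym (ℕ.m+[n∸m]≡n a≤x)) x<a+n)))

    applyUpTo-unique : ∀ a n → Unique (applyUpTo (a ℕ.+_) n)
    applyUpTo-unique a n = applyUpTo⁺₁ (a ℕ.+_) n (λ i<j _ e → ℕ.<⇒≢ i<j (ℕ.+-cancelˡ-≡ a _ _ e))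

  last≈-1 : ∀ q → p ≡ suc q → + q ≈ -1ℤ
  last≈-1 q p≡ = begin
    + q             ≡⟨ lem (+ q) ⟩
    1ℤ + + q + -1ℤ  ≡⟨ cong (λ n → + n + -1ℤ) p≡ ⟨
    + p + -1ℤ       ≈⟨ +-cong p≈0 (≈-refl { -1ℤ}) ⟩
    -1ℤ             ∎
    where
    lem : ∀ x → x ≡ 1ℤ + x + -1ℤ
    lem = solve-∀

  abstract
    -- Let y be the inverse of x. If y = 0, then 1 ≡ 0; if y = 1, then x = 1; if y = p - 1, then x ≡
    -- -1; if y = x, then p divides (x + 1)(x - 1). Each contradicts 2 ≤ x < p - 1.
    proper-inverse : ∀ q → p ≡ suc q → ∀ x → 2 ℕ.≤ x → x ℕ.< q →
      ∃[ y ] 2 ℕ.≤ y × y ℕ.< q × x ≢ y × + x * + y ≈ 1ℤ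
    proper-inverse q p≡ x 2≤x x<q = y
      , ℕ.≤∧≢⇒< (ℕ.n≢0⇒n>0 y≢0) (λ e → y≢1 (sym e))
      , ℕ.≤∧≢⇒< (ℕ.≤-pred (subst (y ℕ.<_) p≡ y<p)) y≢q , x≢y , xy≈1
      where
      suc-x<p : suc x ℕ.< p
      suc-x<p = subst (suc x ℕ.<_) (sym p≡) (s≤s x<q)
      x<p : x ℕ.< p
      x<p = ℕ.<-trans (ℕ.n<1+n x) suc-x<p
      1<p : 1 ℕ.< p
      1<p = ℕ.<-trans 2≤x x<p
      instance
        x≢0 : ℕ.NonZero x
        x≢0 = ℕ.>-nonZero (ℕ.<-trans (s≤s z≤n) 2≤x)
      found : ∃[ y ] y ℕ.< p × + x * + y ≈ 1ℤ
      found = division 1ℤ x x<p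
      y : ℕ
      y = proj₁ found
      y<p : y ℕ.< p
      y<p = proj₁ (proj₂ found)
      xy≈1 : + x * + y ≈ 1ℤ
      xy≈1 = proj₂ (proj₂ found)
      y≢0 : y ≢ 0
      y≢0 y≡0 = p∤ 1<p (≈0⇒∣ (≈-trans (≈-sym xy≈1)
        (≈-reflexive (trans (cong (λ n → + x * + n) y≡0) (ℤ.*-zeroʳ (+ x))))))
      y≢1 : y ≢ 1
      y≢1 y≡1 = ℕ.<⇒≢ 2≤x (sym (≈⇒≡ x<p 1<p (≈-trans
        (≈-reflexive (sym (trans (cong (λ n → + x * + n) y≡1) (ℤ.*-identityʳ (+ x))))) xy≈1)))
      y≢q : y ≢ q
      y≢q y≡q = p∤ suc-x<p (≈0⇒∣ (begin
        1ℤ + + x              ≈⟨ +-cong (≈-sym xy≈1) (≈-refl {+ x}) ⟩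
        + x * + y + + x       ≈⟨ +-cong (*-congˡ (+ x) (≈-trans (≈-reflexive (cong +_ y≡q)) (last≈-1 q p≡))) (≈-refl {+ x}) ⟩
        + x * -1ℤ + + x       ≡⟨ lem (+ x) ⟩
        0ℤ                    ∎))
        where
        lem : ∀ x → x * -1ℤ + x ≡ 0ℤ
        lem = solve-∀
      x≢y : x ≢ y
      x≢y x≡y = Sum.[ p∤ suc-x<p , (λ d → ℕ.<⇒≢ 2≤x (sym (≈⇒≡ x<p 1<p (mk d)))) ]′
        (euclid (1ℤ + + x) (+ x - 1ℤ) (subst (+ p ∣_) (lem (+ x)) (difference x²≈1)))
        where
        x²≈1 : + x * + x ≈ 1ℤ
        x²≈1 = ≈-trans (≈-reflexive (cong (λ n → + x * + n) x≡y)) xy≈1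
        lem : ∀ x → x * x - 1ℤ ≡ (1ℤ + x) * (x - 1ℤ)
        lem = solve-∀

  -- Among 2, …, p - 2, every number has an inverse other than itself.
  wilson : ∀ r → p ≡ 3 ℕ.+ r → + product (applyUpTo suc (2 ℕ.+ r)) ≈ -1ℤ
  wilson r p≡ = ≈-trans (≈-reflexive (cong +_ (product-range r)))
    (≈-trans (≈-reflexive (ℤ.pos-* (product middle) (2 ℕ.+ r)))
             (*-cong middle≈1 (last≈-1 (2 ℕ.+ r) p≡)))
    where
    middle = applyUpTo (2 ℕ.+_) r
    bounds : ∀ {x} → x ∈ middle → 2 ℕ.≤ x × x ℕ.< 2 ℕ.+ r
    bounds = ∈-applyUpTo-from 2 r
    <p : ∀ {x} → x ∈ middle → x ℕ.< p
    <p {x} x∈ = subst (x ℕ.<_) (sym p≡) (ℕ.m<n⇒m<1+n (proj₂ (bounds x∈)))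
    partner : ∀ {x} → x ∈ middle → ∃[ y ] y ∈ middle × x ≢ y × + x * + y ≈ 1ℤ
    partner {x} x∈ = map₂ (λ (2≤y , y<q , rest) → from-∈-applyUpTo 2 r 2≤y y<q , rest) found
      where
      found : ∃[ y ] 2 ℕ.≤ y × y ℕ.< 2 ℕ.+ r × x ≢ y × + x * + y ≈ 1ℤ
      found = proper-inverse (2 ℕ.+ r) p≡ x (proj₁ (bounds x∈)) (proj₂ (bounds x∈))
    unique : ∀ {x y z} → x ∈ middle → y ∈ middle → z ∈ middle →
      + x * + y ≈ 1ℤ → + x * + z ≈ 1ℤ → y ≡ z
    unique x∈ y∈ z∈ = division-unique {{ℕ.>-nonZero (ℕ.<-trans (s≤s z≤n) (proj₁ (bounds x∈)))}}
      (<p x∈) (<p y∈) (<p z∈)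
    middle≈1 : + product middle ≈ 1ℤ
    middle≈1 = finish (product-of-pairs middle (applyUpTo-unique 2 r) partner unique)
      where
      finish : ∃[ j ] length middle ≡ j ℕ.+ j × + product middle ≈ 1ℤ ^ j → + product middle ≈ 1ℤ
      finish (j , _ , e) = ≈-trans e (≈-reflexive (ℤ.^-zeroˡ j))

  -- The partner of x is c/x. It is nonzero because `c` is a unit, and it differs from x because `c`
  -- is not a square. The pairing also shows that p - 1 is even, which supplies `h`.
  units-product : ∀ c q → p ≡ suc q → ¬ + p ∣ c → ¬ IsSquareMod p c →
    ∃[ h ] q ≡ h ℕ.+ h × + product (applyUpTo suc q) ≈ c ^ h
  units-product c q refl p∤c ¬square =
    map₂ (map₁ (trans (sym (length-applyUpTo suc q))))
      (product-of-pairs (applyUpTo suc q) (applyUpTo-unique 1 q) partner unique)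
    where
    bounds : ∀ {x} → x ∈ applyUpTo suc q → 1 ℕ.≤ x × x ℕ.< p
    bounds = ∈-applyUpTo-from 1 q
    partner : ∀ {x} → x ∈ applyUpTo suc q → ∃[ y ] y ∈ applyUpTo suc q × x ≢ y × + x * + y ≈ c
    partner {x} x∈ with division c x {{ℕ.>-nonZero (proj₁ (bounds x∈))}} (proj₂ (bounds x∈))
    ... | zero , y<p , xy≈c = contradiction (≈0⇒∣ (≈-trans (≈-sym xy≈c) (≈-reflexive (ℤ.*-zeroʳ (+ x))))) p∤c
    ... | y@(suc _) , y<p , xy≈c = y , from-∈-applyUpTo 1 q (s≤s z≤n) y<p
      , (λ { refl → ¬square (isSquareMod (+ x) xy≈c) }) , xy≈c
    unique : ∀ {x y z} → x ∈ applyUpTo suc q → y ∈ applyUpTo suc q → z ∈ applyUpTo suc q →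
      + x * + y ≈ c → + x * + z ≈ c → y ≡ z
    unique x∈ y∈ z∈ = division-unique {{ℕ.>-nonZero (proj₁ (bounds x∈))}} (proj₂ (bounds x∈)) (proj₂ (bounds y∈)) (proj₂ (bounds z∈))

  -- Squareness is decidable, so a contradiction from its negation suffices: (p - 1)! would be
  -- congruent both to 2^h ≡ 1 and, by `wilson`, to -1.
  2-isSquare : ¬ (2 ℕ.∣ p) → (+ p) ≡ 1ℤ [mod 8 ] ⊎ (+ p) ≡ -1ℤ [mod 8 ] → IsSquareMod p (+ 2)
  2-isSquare p-odd p≡±1 = decidable-stable (isSquareMod? p (+ 2)) λ ¬square →
    impossible (p ∸ 3) (sym (ℕ.m+[n∸m]≡n 3≤p)) ¬square
    where
    3≤p : 3 ℕ.≤ p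
    3≤p = ℕ.≤∧≢⇒< (ℕ.nonTrivial⇒n>1 p {{prime⇒nonTrivial p-prime}}) λ 2≡p → p-odd (ℕ.∣-reflexive 2≡p)
    double-cancel : ∀ a b → a ℕ.+ a ≡ b ℕ.+ b → a ≡ b
    double-cancel zero    zero    _ = refl
    double-cancel (suc a) (suc b) e = cong suc (double-cancel a b
      (ℕ.suc-injective (trans (sym (ℕ.+-suc a a)) (trans (ℕ.suc-injective e) (ℕ.+-suc b b)))))
    lem8 : ∀ i → i ℕ.* 8 ≡ (i ℕ.+ i ℕ.+ (i ℕ.+ i)) ℕ.+ (i ℕ.+ i ℕ.+ (i ℕ.+ i))
    lem8 = solveℕ-∀
    -- The multiple 8i of 8 is p - 1 = 2h or p + 1 = 2(h + 1); halving gives h = 4i or h + 1 = 4i.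
    h-cases : ∀ h → p ≡ suc (h ℕ.+ h) → (+ p) ≡ 1ℤ [mod 8 ] ⊎ (+ p) ≡ -1ℤ [mod 8 ] →
      ∃[ e ] (h ≡ e ℕ.+ e ℕ.+ (e ℕ.+ e) ⊎ suc h ≡ e ℕ.+ e ℕ.+ (e ℕ.+ e))
    h-cases h eq (inj₁ d) with ∣⇒∣ᵤ (subst (λ n → (+ n) ≡ 1ℤ [mod 8 ]) eq d)
    ... | ℕ.divides i eq′ = i , inj₁ (double-cancel h _ (trans eq′ (lem8 i)))
    h-cases h eq (inj₂ d) with ∣⇒∣ᵤ (subst (λ n → (+ n) ≡ -1ℤ [mod 8 ]) eq d)
    ... | ℕ.divides i eq′ = i , inj₂ (double-cancel (suc h) _ (trans (lem h) (trans eq′ (lem8 i))))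
      where
      lem : ∀ h → suc h ℕ.+ suc h ≡ suc (h ℕ.+ h) ℕ.+ 1
      lem = solveℕ-∀
    impossible : ∀ r → p ≡ 3 ℕ.+ r → ¬ ¬ IsSquareMod p (+ 2)
    impossible r p≡ ¬square with units-product (+ 2) (2 ℕ.+ r) p≡ (p∤ 3≤p) ¬square
    ... | h , q≡ , prod with p≡′ ← trans p≡ (cong suc q≡) with h-cases h p≡′ p≡±1
    -- The difference 1 - (-1) evaluates to 2, which `p` cannot divide.
    ...   | e , cases = p∤ 3≤p (difference 1≈-1)
      where
      1≈-1 : 1ℤ ≈ -1ℤ
      1≈-1 = ≈-trans (≈-sym (2^h≈1 h e p≡′ cases)) (≈-trans (≈-sym prod) (wilson r p≡))

-- Counting by sums of indicators

𝟙 : ∀ {P : Set} → Dec P → ℕ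
𝟙 P? = if does P? then 1 else 0

𝟙-cong : ∀ {P Q : Set} (P? : Dec P) (Q? : Dec Q) → (P → Q) → (Q → P) → 𝟙 P? ≡ 𝟙 Q?
𝟙-cong (yes _) (yes _) _ _ = refl
𝟙-cong (no _)  (no _)  _ _ = refl
𝟙-cong (yes a) (no ¬b) f _ = contradiction (f a) ¬b
𝟙-cong (no ¬a) (yes b) _ g = contradiction (g b) ¬a

𝟙-false : ∀ {P : Set} (P? : Dec P) → ¬ P → 𝟙 P? ≡ 0
𝟙-false (yes a) ¬a = contradiction a ¬a
𝟙-false (no _)  _  = refl

length-filter-∷ : ∀ {A : Set} {P : Pred A 0ℓ} (P? : Decidable P) x xs →
  length (filter P? (x ∷ xs)) ≡ 𝟙 (P? x) ℕ.+ length (filter P? xs)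
length-filter-∷ P? x xs with P? x
... | yes _ = refl
... | no  _ = refl

length-filter-tabulate : ∀ {A : Set} {n} {P : Pred A 0ℓ} (P? : Decidable P) (f : Fin n → A) →
  length (filter P? (tabulate f)) ≡ ∑[ i < n ] 𝟙 (P? (f i))
length-filter-tabulate {n = zero}  P? f = refl
length-filter-tabulate {n = suc n} P? f = trans (length-filter-∷ P? (f Fin.zero) _)
  (cong (𝟙 (P? (f Fin.zero)) ℕ.+_) (length-filter-tabulate P? (f ∘ Fin.suc)))

length-filter-applyUpTo : ∀ {A : Set} {P : Pred A 0ℓ} (P? : Decidable P) f n →
  length (filter P? (applyUpTo f n)) ≡ ∑[ i < n ] 𝟙 (P? (f (toℕ i)))
length-filter-applyUpTo P? f zero    = refl
length-filter-applyUpTo P? f (suc n) = trans (length-filter-∷ P? (f 0) _)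
  (cong (𝟙 (P? (f 0)) ℕ.+_) (length-filter-applyUpTo P? (f ∘ suc) n))

length-filter-product : ∀ {A B : Set} {m n} {P : Pred (A × B) 0ℓ} (P? : Decidable P)
  (f : Fin m → A) (g : Fin n → B) →
  length (filter P? (cartesianProduct (tabulate f) (tabulate g))) ≡
  ∑[ i < m ] ∑[ j < n ] 𝟙 (P? (f i , g j))
length-filter-product {m = zero}  P? f g = refl
length-filter-product {m = suc m} {n} P? f g = begin
  length (filter P? (row ++ rows))                         ≡⟨ cong length (filter-++ P? row rows) ⟩
  length (filter P? row ++ filter P? rows)                 ≡⟨ length-++ (filter P? row) ⟩
  length (filter P? row) ℕ.+ length (filter P? rows)
    ≡⟨ cong (λ xs → length (filter P? xs) ℕ.+ length (filter P? rows)) (map-tabulate g (f Fin.zero ,_)) ⟩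
  length (filter P? (tabulate λ j → f Fin.zero , g j)) ℕ.+ length (filter P? rows)
    ≡⟨ cong₂ ℕ._+_ (length-filter-tabulate P? (λ j → f Fin.zero , g j)) (length-filter-product P? (f ∘ Fin.suc) g) ⟩
  ∑[ j < n ] 𝟙 (P? (f Fin.zero , g j)) ℕ.+ ∑[ i < m ] ∑[ j < n ] 𝟙 (P? (f (Fin.suc i) , g j)) ∎
  where
  open ≡-Reasoning
  row = map (f Fin.zero ,_) (tabulate g)
  rows = cartesianProduct (tabulate (f ∘ Fin.suc)) (tabulate g)

-- The shape comes from `edges`, which filters pairs of indices before mapping them to vertices;
-- both tests are merged into one on indices.
length-filter-map-filter : ∀ {A B : Set} {P : Pred B 0ℓ} {Q : Pred A 0ℓ} (P? : Decidable P)
  (f : A → B) (Q? : Decidable Q) xs →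
  length (filter P? (map f (filter Q? xs))) ≡ length (filter (λ x → Q? x ×-dec P? (f x)) xs)
length-filter-map-filter P? f Q? [] = refl
length-filter-map-filter P? f Q? (x ∷ xs) with Q? x
... | no _ = length-filter-map-filter P? f Q? xs
... | yes _ with P? (f x)
...   | yes _ = cong suc (length-filter-map-filter P? f Q? xs)
...   | no  _ = length-filter-map-filter P? f Q? xs

sum-zero : ∀ {n} (t : Fin n → ℕ) → (∀ i → t i ≡ 0) → sum t ≡ 0
sum-zero {n} t t≡0 = trans (sum-cong-≗ t≡0) (sum-replicate-zero n)

sum-single : ∀ {n} (t : Fin n → ℕ) i → (∀ j → i ≢ j → t j ≡ 0) → sum t ≡ t i
sum-single t Fin.zero    off = trans
  (cong (t Fin.zero ℕ.+_) (sum-zero _ λ j → off (Fin.suc j) λ ()))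
  (ℕ.+-identityʳ _)
sum-single t (Fin.suc i) off = cong₂ ℕ._+_ (off Fin.zero λ ())
  (sum-single (t ∘ Fin.suc) i λ j i≢j → off (Fin.suc j) (i≢j ∘ suc-injective))

sum-splitAt : ∀ m {n} (t : Fin (m ℕ.+ n) → ℕ) → sum t ≡ ∑[ i < m ] t (i ↑ˡ n) ℕ.+ ∑[ j < n ] t (m ↑ʳ j)
sum-splitAt zero    t = refl
sum-splitAt (suc m) t = trans (cong (t Fin.zero ℕ.+_) (sum-splitAt m (t ∘ Fin.suc))) (sym (ℕ.+-assoc (t Fin.zero) _ _))

sum-combine : ∀ m {n} (t : Fin (m ℕ.* n) → ℕ) → sum t ≡ ∑[ i < m ] ∑[ j < n ] t (combine i j)
sum-combine zero        t = refl
sum-combine (suc m) {n} t = trans (sum-splitAt n t)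
  (cong (sum (λ j → t (j ↑ˡ (m ℕ.* n))) ℕ.+_) (sum-combine m (t ∘ (n ↑ʳ_))))

-- Counting the edges of a graph and of a corona

vertex-injective : ∀ (Γ : Graph) {i j} → Graph.vertex Γ i ≡ Graph.vertex Γ j → i ≡ j
vertex-injective Γ = Injection.injective (↔⇒↣ (Graph.enum Γ))

module _ (Γ : Graph) where
  open Graph Γ

  module _ {P : Pred (V × V) 0ℓ} (P? : Decidable P) where

    Counted : Fin order → Fin order → Set
    Counted i j = (i Fin.< j × vertex i ~ vertex j) × P (vertex i , vertex j)

    counted? : ∀ i j → Dec (Counted i j)
    counted? i j = ((i Fin.<? j) ×-dec (vertex i ~? vertex j)) ×-dec P? (vertex i , vertex j)

    length-filter-edges : length (filter P? edges) ≡ ∑[ i < order ] ∑[ j < order ] 𝟙 (counted? i j)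
    length-filter-edges = trans
      (length-filter-map-filter P? (λ (i , j) → vertex i , vertex j) (λ (i , j) → (i Fin.<? j) ×-dec (vertex i ~? vertex j))
        (cartesianProduct (allFin order) (allFin order)))
      (length-filter-product {P = λ (i , j) → Counted i j} (λ (i , j) → counted? i j) (λ i → i) (λ j → j))

module _ (G H : Graph) where
  private
    module G = Graph G
    module H = Graph H
    module X = Graph (G ∘ᶜ H)

  -- `base` and `leaf` follow the enumeration of the corona, which lists the vertices of `G` first
  -- and then the copies of `H` one after the other.
  base : Fin G.order → Fin X.order
  base i = i ↑ˡ (G.order ℕ.* H.order)

  leaf : Fin G.order → Fin H.order → Fin X.order
  leaf i j = G.order ↑ʳ combine i j

  vertex-base : ∀ i → X.vertex (base i) ≡ inj₁ (G.vertex i)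
  vertex-base i rewrite splitAt-↑ˡ G.order i (G.order ℕ.* H.order) = refl

  vertex-leaf : ∀ i j → X.vertex (leaf i j) ≡ inj₂ (G.vertex i , H.vertex j)
  vertex-leaf i j rewrite splitAt-↑ʳ G.order (G.order ℕ.* H.order) (combine i j) =
    cong (λ (i , j) → inj₂ (G.vertex i , H.vertex j)) (remQuot-combine i j)

  sum-vertices : ∀ (t : Fin X.order → ℕ) →
    sum t ≡ ∑[ i < G.order ] t (base i) ℕ.+ ∑[ i < G.order ] ∑[ j < H.order ] t (leaf i j)
  sum-vertices t = trans (sum-splitAt G.order t)
    (cong (sum (t ∘ base) ℕ.+_) (sum-combine G.order (λ k → t (G.order ↑ʳ k))))

  -- Edges are listed with the earlier endpoint first, so this order makes every spoke count once,
  -- from base to leaf.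
  base<leaf : ∀ i i′ j → base i Fin.< leaf i′ j
  base<leaf i i′ j = subst₂ ℕ._<_ (sym (toℕ-↑ˡ i _)) (sym (toℕ-↑ʳ G.order (combine i′ j)))
    (ℕ.<-≤-trans (toℕ<n i) (ℕ.m≤m+n _ _))

  toℕ-leaf : ∀ i j → toℕ (leaf i j) ≡ G.order ℕ.+ (H.order ℕ.* toℕ i ℕ.+ toℕ j)
  toℕ-leaf i j = trans (toℕ-↑ʳ G.order (combine i j)) (cong (G.order ℕ.+_) (toℕ-combine i j))

  module _ {P : Pred (X.V × X.V) 0ℓ} (P? : Decidable P) where
    private
      Q : X.V × X.V → Set
      Q (u , v) = u X.~ v × P (u , v)

      -- Adjacency in the corona reduces only on explicit injections, so it is transported along
      -- equations such as `vertex-base` and `vertex-leaf`.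
      counted⇒ : ∀ {x y u v} → X.vertex x ≡ u → X.vertex y ≡ v → Counted (G ∘ᶜ H) P? x y → x Fin.< y × Q (u , v)
      counted⇒ refl refl ((x<y , a) , b) = x<y , a , b

      ⇒counted : ∀ {x y u v} → X.vertex x ≡ u → X.vertex y ≡ v → x Fin.< y × Q (u , v) → Counted (G ∘ᶜ H) P? x y
      ⇒counted refl refl (x<y , a , b) = (x<y , a) , b

      t : Fin X.order → Fin X.order → ℕ
      t x y = 𝟙 (counted? (G ∘ᶜ H) P? x y)

      t-base-base : ∀ i i′ → t (base i) (base i′) ≡ 𝟙 (counted? G (λ (u , v) → P? (inj₁ u , inj₁ v)) i i′)
      t-base-base i i′ = 𝟙-cong (counted? (G ∘ᶜ H) P? (base i) (base i′))
        (counted? G (λ (u , v) → P? (inj₁ u , inj₁ v)) i i′)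
        (λ c → let i<i′ , a , b = counted⇒ (vertex-base i) (vertex-base i′) c in
          (subst₂ ℕ._<_ (toℕ-↑ˡ i _) (toℕ-↑ˡ i′ _) i<i′ , a) , b)
        (λ ((i<i′ , a) , b) → ⇒counted (vertex-base i) (vertex-base i′)
          (subst₂ ℕ._<_ (sym (toℕ-↑ˡ i _)) (sym (toℕ-↑ˡ i′ _)) i<i′ , a , b))

      t-base-leaf : ∀ i j → t (base i) (leaf i j) ≡ 𝟙 (P? (inj₁ (G.vertex i) , inj₂ (G.vertex i , H.vertex j)))
      t-base-leaf i j = 𝟙-cong (counted? (G ∘ᶜ H) P? (base i) (leaf i j))
        (P? (inj₁ (G.vertex i) , inj₂ (G.vertex i , H.vertex j)))
        (λ c → proj₂ (proj₂ (counted⇒ (vertex-base i) (vertex-leaf i j) c)))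
        (λ b → ⇒counted (vertex-base i) (vertex-leaf i j) (base<leaf i i j , refl , b))

      t-base-leaf-off : ∀ i i′ j → i ≢ i′ → t (base i) (leaf i′ j) ≡ 0
      t-base-leaf-off i i′ j i≢i′ = 𝟙-false (counted? (G ∘ᶜ H) P? (base i) (leaf i′ j)) λ c →
        i≢i′ (vertex-injective G (proj₁ (proj₂ (counted⇒ (vertex-base i) (vertex-leaf i′ j) c))))

      t-leaf-base : ∀ i j i′ → t (leaf i j) (base i′) ≡ 0
      t-leaf-base i j i′ = 𝟙-false (counted? (G ∘ᶜ H) P? (leaf i j) (base i′)) λ c →
        ℕ.<-asym (base<leaf i′ i j) (proj₁ (counted⇒ refl refl c))

      t-leaf-leaf : ∀ i j j′ → t (leaf i j) (leaf i j′) ≡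
        𝟙 (counted? H (λ (u , v) → P? (inj₂ (G.vertex i , u) , inj₂ (G.vertex i , v))) j j′)
      t-leaf-leaf i j j′ = 𝟙-cong (counted? (G ∘ᶜ H) P? (leaf i j) (leaf i j′))
        (counted? H (λ (u , v) → P? (inj₂ (G.vertex i , u) , inj₂ (G.vertex i , v))) j j′)
        (λ c → let l<l′ , (_ , a) , b = counted⇒ (vertex-leaf i j) (vertex-leaf i j′) c in
          (ℕ.+-cancelˡ-< (H.order ℕ.* toℕ i) _ _ (ℕ.+-cancelˡ-< G.order _ _
            (subst₂ ℕ._<_ (toℕ-leaf i j) (toℕ-leaf i j′) l<l′)) , a) , b)
        (λ ((j<j′ , a) , b) → ⇒counted (vertex-leaf i j) (vertex-leaf i j′)
          (subst₂ ℕ._<_ (sym (toℕ-leaf i j)) (sym (toℕ-leaf i j′))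
            (ℕ.+-monoʳ-< G.order (ℕ.+-monoʳ-< (H.order ℕ.* toℕ i) j<j′)) , (refl , a) , b))

      t-leaf-leaf-off : ∀ i j i′ j′ → i ≢ i′ → t (leaf i j) (leaf i′ j′) ≡ 0
      t-leaf-leaf-off i j i′ j′ i≢i′ = 𝟙-false (counted? (G ∘ᶜ H) P? (leaf i j) (leaf i′ j′)) λ c →
        i≢i′ (vertex-injective G (proj₁ (proj₁ (proj₂ (counted⇒ (vertex-leaf i j) (vertex-leaf i′ j′) c)))))

    -- The sum over pairs of indices falls into four blocks. Base-base gives the edges of `G`, and
    -- leaf-base vanishes by the order of the indices. In base-leaf and leaf-leaf only equal copy
    -- indices contribute, giving the spokes and the edges inside the copies.
    length-filter-corona-edges : length (filter P? X.edges) ≡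
      length (filter (λ (u , v) → P? (inj₁ u , inj₁ v)) G.edges)
      ℕ.+ ∑[ i < G.order ] (∑[ j < H.order ] 𝟙 (P? (inj₁ (G.vertex i) , inj₂ (G.vertex i , H.vertex j)))
        ℕ.+ length (filter (λ (u , v) → P? (inj₂ (G.vertex i , u) , inj₂ (G.vertex i , v))) H.edges))
    length-filter-corona-edges = begin
      length (filter P? X.edges)
        ≡⟨ length-filter-edges (G ∘ᶜ H) P? ⟩
      ∑[ x < X.order ] sum (t x)
        ≡⟨ sum-vertices (λ x → sum (t x)) ⟩
      ∑[ i < G.order ] sum (t (base i)) ℕ.+ ∑[ i < G.order ] ∑[ j < H.order ] sum (t (leaf i j))
        ≡⟨ cong₂ ℕ._+_ (trans (sum-cong-≗ from-base) (∑-distrib-+ inG spokes)) (sum-cong-≗ from-leaves) ⟩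
      sum inG ℕ.+ sum spokes ℕ.+ sum inH
        ≡⟨ ℕ.+-assoc (sum inG) _ _ ⟩
      sum inG ℕ.+ (sum spokes ℕ.+ sum inH)
        ≡⟨ cong₂ ℕ._+_ (sym (length-filter-edges G (λ (u , v) → P? (inj₁ u , inj₁ v)))) (sym (∑-distrib-+ spokes inH)) ⟩
      length (filter (λ (u , v) → P? (inj₁ u , inj₁ v)) G.edges) ℕ.+ ∑[ i < G.order ] (spokes i ℕ.+ inH i) ∎
      where
      open ≡-Reasoning
      inG spokes inH : Fin G.order → ℕ
      inG i = ∑[ i′ < G.order ] 𝟙 (counted? G (λ (u , v) → P? (inj₁ u , inj₁ v)) i i′)
      spokes i = ∑[ j < H.order ] 𝟙 (P? (inj₁ (G.vertex i) , inj₂ (G.vertex i , H.vertex j)))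
      inH i = length (filter (λ (u , v) → P? (inj₂ (G.vertex i , u) , inj₂ (G.vertex i , v))) H.edges)

      from-base : ∀ i → sum (t (base i)) ≡ inG i ℕ.+ spokes i
      from-base i = trans (sum-vertices (t (base i))) (cong₂ ℕ._+_
        (sum-cong-≗ (t-base-base i))
        (trans (sum-single _ i λ i′ i≢i′ → sum-zero _ λ j → t-base-leaf-off i i′ j i≢i′)
               (sum-cong-≗ (t-base-leaf i))))

      from-leaf : ∀ i j → sum (t (leaf i j)) ≡
        ∑[ j′ < H.order ] 𝟙 (counted? H (λ (u , v) → P? (inj₂ (G.vertex i , u) , inj₂ (G.vertex i , v))) j j′)
      from-leaf i j = trans (sum-vertices (t (leaf i j))) (cong₂ ℕ._+_
        (sum-zero _ (t-leaf-base i j))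
        (trans (sum-single _ i λ i′ i≢i′ → sum-zero _ λ j′ → t-leaf-leaf-off i j i′ j′ i≢i′)
               (sum-cong-≗ (t-leaf-leaf i j))))

      from-leaves : ∀ i → ∑[ j < H.order ] sum (t (leaf i j)) ≡ inH i
      from-leaves i = trans (sum-cong-≗ (from-leaf i)) (sym (length-filter-edges H _))

-- Legendre symbols and edge labels

module _ (p : ℕ) where
  open Congruence p

  legendre-∣ : ∀ x → + p ∣ x → legendre x p ≡ 0ℤ
  legendre-∣ x d with + p ∣? x
  ... | yes _ = refl
  ... | no ¬d = contradiction d ¬d

  legendre-square : ∀ x → ¬ + p ∣ x → IsSquareMod p x → legendre x p ≡ 1ℤ
  legendre-square x ¬d s with + p ∣? x
  ... | yes d = contradiction d ¬d
  ... | no _ with isSquareMod? p x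
  ...   | yes _ = refl
  ...   | no ¬s = contradiction s ¬s

  legendre-nonsquare : ∀ x → ¬ + p ∣ x → ¬ IsSquareMod p x → legendre x p ≡ -1ℤ
  legendre-nonsquare x ¬d ¬s with + p ∣? x
  ... | yes d = contradiction d ¬d
  ... | no _ with isSquareMod? p x
  ...   | yes s = contradiction s ¬s
  ...   | no _ = refl

  edgeLabel-∣ : ∀ x → + p ∣ x → edgeLabel p x ≡ 0ℤ
  edgeLabel-∣ x d with + p ∣? x
  ... | yes _ = refl
  ... | no ¬d = contradiction d ¬d

  edgeLabel-∤ : ∀ x → ¬ + p ∣ x → edgeLabel p x ≡ (1ℤ + legendre x p) / + 2
  edgeLabel-∤ x ¬d with + p ∣? x in eq
  ... | yes d = contradiction d ¬d
  ... | no _ rewrite eq = refl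

  -- One case split fixes the Legendre symbol and the edge label together, without unfolding their
  -- nested tests.
  data Residue (x : ℤ) : Set where
    divisible : + p ∣ x → legendre x p ≡ 0ℤ → edgeLabel p x ≡ 0ℤ → Residue x
    square    : ¬ + p ∣ x → IsSquareMod p x → legendre x p ≡ 1ℤ → edgeLabel p x ≡ 1ℤ → Residue x
    nonsquare : ¬ + p ∣ x → ¬ IsSquareMod p x → legendre x p ≡ -1ℤ → edgeLabel p x ≡ 0ℤ → Residue x

  residue : ∀ x → Residue x
  residue x = classify (+ p ∣? x) (isSquareMod? p x)
    where
    classify : Dec (+ p ∣ x) → Dec (IsSquareMod p x) → Residue x
    classify (yes d) _ = divisible d (legendre-∣ x d) (edgeLabel-∣ x d)
    classify (no ¬d) (yes s) = square ¬d s l (trans (edgeLabel-∤ x ¬d) (cong (λ z → (1ℤ + z) / + 2) l))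
      where l = legendre-square x ¬d s
    classify (no ¬d) (no ¬s) = nonsquare ¬d ¬s l (trans (edgeLabel-∤ x ¬d) (cong (λ z → (1ℤ + z) / + 2) l))
      where l = legendre-nonsquare x ¬d ¬s

  edgeLabel-cong : ∀ {x y} → (+ p ∣ x → + p ∣ y) → (+ p ∣ y → + p ∣ x) →
    (IsSquareMod p x → IsSquareMod p y) → (IsSquareMod p y → IsSquareMod p x) → edgeLabel p x ≡ edgeLabel p y
  edgeLabel-cong {x} {y} d⇒ ⇐d s⇒ ⇐s with residue x | residue y
  ... | divisible _ _ a       | divisible _ _ b       = trans a (sym b)
  ... | divisible d _ _       | square ¬d _ _ _       = contradiction (d⇒ d) ¬d
  ... | divisible _ _ a       | nonsquare _ _ _ b     = trans a (sym b)
  ... | square ¬d _ _ _       | divisible d _ _       = contradiction (⇐d d) ¬d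
  ... | square _ _ _ a        | square _ _ _ b        = trans a (sym b)
  ... | square _ s _ _        | nonsquare _ ¬s _ _    = contradiction (s⇒ s) ¬s
  ... | nonsquare _ _ _ a     | divisible _ _ b       = trans a (sym b)
  ... | nonsquare _ ¬s _ _    | square _ s _ _        = contradiction (⇐s s) ¬s
  ... | nonsquare _ _ _ a     | nonsquare _ _ _ b     = trans a (sym b)

  𝟙-edgeLabel-1 : ∀ x → 𝟙 (edgeLabel p x ℤ.≟ 1ℤ) ≡ 𝟙 (legendre x p ℤ.≟ 1ℤ)
  𝟙-edgeLabel-1 x with residue x
  ... | divisible _ l e rewrite l | e = refl
  ... | square _ _ l e rewrite l | e = refl
  ... | nonsquare _ _ l e rewrite l | e = refl

  -- Label 0 is given both to non-squares and to multiples of `p`, the two classes that `IsPL`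
  -- subtracts.
  𝟙-edgeLabel-0 : ∀ x → 𝟙 (edgeLabel p x ℤ.≟ 0ℤ) ≡ 𝟙 (legendre x p ℤ.≟ -1ℤ) ℕ.+ 𝟙 (legendre x p ℤ.≟ 0ℤ)
  𝟙-edgeLabel-0 x with residue x
  ... | divisible _ l e rewrite l | e = refl
  ... | square _ _ l e rewrite l | e = refl
  ... | nonsquare _ _ l e rewrite l | e = refl

  isSquareMod-resp-≈ : ∀ {x y} → x ≈ y → IsSquareMod p x → IsSquareMod p y
  isSquareMod-resp-≈ x≈y (w , ww≡x) = w , difference (≈-trans {+ toℕ w * + toℕ w} (mk ww≡x) x≈y)

  edgeLabel-resp-≈ : ∀ {x y} → x ≈ y → edgeLabel p x ≡ edgeLabel p y
  edgeLabel-resp-≈ x≈y = edgeLabel-cong (∣-resp-≈ x≈y) (∣-resp-≈ (≈-sym x≈y))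
    (isSquareMod-resp-≈ x≈y) (isSquareMod-resp-≈ (≈-sym x≈y))

module _ (p : ℕ) (p-prime : Prime p) (p-odd : ¬ (2 ℕ.∣ p)) (2-square : IsSquareMod p (+ 2)) where
  open PrimeModulus p p-prime

  private
    instance _ = prime⇒nonZero p-prime
    c : ℤ
    c = + toℕ (proj₁ 2-square)
    c²≈2 : c * c ≈ + 2
    c²≈2 = mk (proj₂ 2-square)
    2<p : 2 ℕ.< p
    2<p = ℕ.≤∧≢⇒< (ℕ.nonTrivial⇒n>1 p {{prime⇒nonTrivial p-prime}}) (λ 2≡p → p-odd (ℕ.∣-reflexive 2≡p))

  -- As 2 is both a unit and a square modulo `p`, multiplying by it preserves and reflects
  -- divisibility by `p` and squareness.
  edgeLabel-double : ∀ x → edgeLabel p (x + x) ≡ edgeLabel p x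
  edgeLabel-double x = edgeLabel-cong p halve double halve-square double-square
    where
    double≡ : ∀ x → x + x ≡ + 2 * x
    double≡ = solve-∀
    halve : + p ∣ x + x → + p ∣ x
    halve d = Sum.[ (λ e → contradiction e (p∤ 2<p)) , (λ e → e) ]′ (euclid (+ 2) x (subst (+ p ∣_) (double≡ x) d))
    double : + p ∣ x → + p ∣ x + x
    double d = ≈0⇒∣ (+-cong (∣⇒≈0 d) (∣⇒≈0 d))
    square-* : ∀ a b → a * b * (a * b) ≡ a * a * (b * b)
    square-* = solve-∀
    double-square : IsSquareMod p x → IsSquareMod p (x + x)
    double-square (y , yy≡x) = isSquareMod (c * + toℕ y) (≈-trans (≈-reflexive (square-* c (+ toℕ y)))
      (≈-trans (*-cong c²≈2 (mk yy≡x)) (≈-reflexive (sym (double≡ x)))))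
    halve-square : IsSquareMod p (x + x) → IsSquareMod p x
    -- With `h` the inverse of 2, `c * h` is a square root of 1/2, because c²h² ≡ 2h² ≡ h.
    halve-square (y , yy≡2x) with h , 2h≈1 ← inverse 2 2<p = isSquareMod (c * h * w) (begin
      c * h * w * (c * h * w)       ≡⟨ lem₁ c h w ⟩
      c * c * (h * h) * (w * w)     ≈⟨ *-cong (*-congʳ (h * h) c²≈2) (mk yy≡2x) ⟩
      + 2 * (h * h) * (x + x)       ≡⟨ lem₂ h x ⟩
      + 2 * h * (+ 2 * h) * x       ≈⟨ *-congʳ x (*-cong 2h≈1 2h≈1) ⟩
      1ℤ * 1ℤ * x                   ≡⟨ ℤ.*-identityˡ x ⟩
      x                             ∎)
      where
      open import Relation.Binary.Reasoning.Setoid ≈-setoid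
      w = + toℕ y
      lem₁ : ∀ c h y → c * h * y * (c * h * y) ≡ c * c * (h * h) * (y * y)
      lem₁ = solve-∀
      lem₂ : ∀ h x → + 2 * (h * h) * (x + x) ≡ + 2 * h * (+ 2 * h) * x
      lem₂ = solve-∀

-- Periodicity of the sequence

module _ {p : ℕ} {a b : ℤ} where
  open Congruence p

  -- The index has the form in which `toℕ-combine` presents a label: quotient times period plus
  -- residue.
  F-periodic : ∀ {t} → IsPeriodMod p a b t → ∀ q r → F a b (t ℕ.* q ℕ.+ r) ≈ F a b r
  F-periodic {t} per zero    r = ≈-reflexive (cong (λ n → F a b (n ℕ.+ r)) (ℕ.*-zeroʳ t))
  F-periodic {t} per (suc q) r = ≈-trans (≈-reflexive (cong (F a b) index))
    (≈-trans (mk (per (t ℕ.* q ℕ.+ r))) (F-periodic per q r))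
    where
    index : t ℕ.* suc q ℕ.+ r ≡ t ℕ.* q ℕ.+ r ℕ.+ t
    index = trans (cong (ℕ._+ r) (ℕ.*-suc t q)) (trans (ℕ.+-assoc t _ r) (ℕ.+-comm t _))

-- A period occurs both inside `IsPL` and as `π`; the leastness of each identifies the two.
pisanoPeriod-unique : ∀ {p a b s t} → IsPisanoPeriod p a b s → IsPisanoPeriod p a b t → s ≡ t
pisanoPeriod-unique {s = s} {t} P Q = ℕ.≤-antisym
  (P.least t Q.positive Q.period) (Q.least s P.positive P.period)
  where
  module P = IsPisanoPeriod P
  module Q = IsPisanoPeriod Q

-- Connectedness and labeling of the corona

module _ (G H : Graph) where
  private
    module G = Graph G
    module H = Graph H
    module X = Graph (G ∘ᶜ H)

  -- Every vertex equals or is adjacent to its root in `G`, so a path between the roots extends at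
  -- both ends.
  corona-connected : G.Connected → X.Connected
  corona-connected conn u v = to-root u ◅◅ gmap inj₁ (λ e → e) (conn (root u) (root v)) ◅◅ from-root v
    where
    root : X.V → G.V
    root (inj₁ g)       = g
    root (inj₂ (g , _)) = g
    to-root : ∀ u → Star X._~_ u (inj₁ (root u))
    to-root (inj₁ g)       = Path.ε
    to-root (inj₂ (g , h)) = refl ◅ Path.ε
    from-root : ∀ u → Star X._~_ (inj₁ (root u)) u
    from-root (inj₁ g)       = Path.ε
    from-root (inj₂ (g , h)) = refl ◅ Path.ε

  module Labeling (orders : H.order ≡ G.order) where
    private
      n = G.order

      -- For period n + 1 a label amounts to a quotient below n and a residue below n + 1, the two
      -- components of `position`.
      order≡ : n ℕ.* suc n ≡ X.order
      order≡ = trans (ℕ.*-suc n n) (cong (λ h → n ℕ.+ n ℕ.* h) (sym orders))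

    index : G.V → Fin n
    index = Inverse.from G.enum

    leafIndex : H.V → Fin n
    leafIndex h = Fin.cast orders (Inverse.from H.enum h)

    -- Residue 0 modulo n + 1 marks the vertices of G, and residue i + 1 the copy of H at the i-th vertex of G.
    private
      position : X.V → Fin n × Fin (suc n)
      position (inj₁ g)       = index g , Fin.zero
      position (inj₂ (g , h)) = leafIndex h , Fin.suc (index g)

      to : X.V → Fin X.order
      to v = Fin.cast order≡ (combine (proj₁ (position v)) (proj₂ (position v)))

      index-injective : ∀ {g g′} → index g ≡ index g′ → g ≡ g′
      index-injective {g} {g′} e = trans (sym (Inverse.strictlyInverseˡ G.enum g))
        (trans (cong G.vertex e) (Inverse.strictlyInverseˡ G.enum g′))

      leafIndex-injective : ∀ {h h′} → leafIndex h ≡ leafIndex h′ → h ≡ h′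
      leafIndex-injective {h} {h′} e = trans (sym (Inverse.strictlyInverseˡ H.enum h))
        (trans (cong H.vertex (cast-injective e)) (Inverse.strictlyInverseˡ H.enum h′))
        where
        cast-injective : ∀ {i j} → Fin.cast orders i ≡ Fin.cast orders j → i ≡ j
        cast-injective {i} {j} e = trans (sym (cast-involutive (sym orders) orders i))
          (trans (cong (Fin.cast (sym orders)) e) (cast-involutive (sym orders) orders j))

      position-injective : ∀ u v →
        proj₁ (position u) ≡ proj₁ (position v) × proj₂ (position u) ≡ proj₂ (position v) → u ≡ v
      position-injective (inj₁ _) (inj₁ _) (e , _) = cong inj₁ (index-injective e)
      position-injective (inj₂ _) (inj₂ _) (e , e′) =
        cong inj₂ (cong₂ _,_ (index-injective (suc-injective e′)) (leafIndex-injective e))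
      position-injective (inj₁ _) (inj₂ _) (_ , ())
      position-injective (inj₂ _) (inj₁ _) (_ , ())

      position-surjective : ∀ i j → ∃[ v ] position v ≡ (i , j)
      position-surjective i Fin.zero    = inj₁ (G.vertex i) , cong (_, Fin.zero) (Inverse.strictlyInverseʳ G.enum i)
      position-surjective i (Fin.suc j) = inj₂ (G.vertex j , H.vertex (Fin.cast (sym orders) i))
        , cong₂ _,_ (trans (cong (Fin.cast orders) (Inverse.strictlyInverseʳ H.enum _)) (cast-involutive orders (sym orders) i))
                    (cong Fin.suc (Inverse.strictlyInverseʳ G.enum j))

      to-injective : ∀ {u v} → to u ≡ to v → u ≡ v
      to-injective {u} {v} e = position-injective u v (combine-injective _ _ _ _
        (trans (sym (cast-involutive (sym order≡) order≡ _))
          (trans (cong (Fin.cast (sym order≡)) e) (cast-involutive (sym order≡) order≡ _))))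

      to-surjective : ∀ y → ∃[ v ] to v ≡ y
      to-surjective y with combine-surjective {n} {suc n} (Fin.cast (sym order≡) y)
      ... | i , j , e with position-surjective i j
      ... | v , e′ = v , trans (cong (λ (i , j) → Fin.cast order≡ (combine i j)) e′)
        (trans (cong (Fin.cast order≡) e) (cast-involutive order≡ (sym order≡) y))

    labeling : X.V ⤖ Fin X.order
    labeling = mk⤖ {to = to} (to-injective , strictlySurjective⇒surjective to-surjective)

    -- The summand 0 is kept so that `F-periodic` applies with residue 0.
    toℕ-labeling-base : ∀ g → toℕ (Bijection.to labeling (inj₁ g)) ≡ suc n ℕ.* toℕ (index g) ℕ.+ 0
    toℕ-labeling-base g = trans (toℕ-cast order≡ _) (toℕ-combine (index g) Fin.zero)

    toℕ-labeling-leaf : ∀ g h → toℕ (Bijection.to labeling (inj₂ (g , h))) ≡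
      suc n ℕ.* toℕ (leafIndex h) ℕ.+ suc (toℕ (index g))
    toℕ-labeling-leaf g h = trans (toℕ-cast order≡ _) (toℕ-combine (leafIndex h) (Fin.suc (index g)))

-- Edge counts of the labeling

-- The alternative of an empty list serves the case m = 0, where doubling may change a label but no
-- edge lies inside a copy.
length-filter-≟-const : ∀ {A : Set} (label : A → ℤ) ℓ c xs → (∀ e → label e ≡ ℓ) ⊎ length xs ≡ 0 →
  length (filter (λ e → label e ℤ.≟ c) xs) ≡ length xs ℕ.* 𝟙 (ℓ ℤ.≟ c)
length-filter-≟-const label ℓ c []       _            = refl
length-filter-≟-const label ℓ c (x ∷ xs) (inj₁ const) = trans (length-filter-∷ (λ e → label e ℤ.≟ c) x xs)
  (cong₂ ℕ._+_ (cong (λ z → 𝟙 (z ℤ.≟ c)) (const x)) (length-filter-≟-const label ℓ c xs (inj₁ const)))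

-- The index 0 is split off because the copies of `H` carry only the residues 1, ..., n.
length-Λ : ∀ p a b n j → length (Λ p a b (suc n) j) ≡
  𝟙 (legendre a p ℤ.≟ j) ℕ.+ ∑[ i < n ] 𝟙 (legendre (F a b (suc (toℕ i))) p ℤ.≟ j)
length-Λ p a b n j = length-filter-applyUpTo (λ ξ → legendre (F a b ξ) p ℤ.≟ j) (λ ξ → ξ) (suc n)

∣m-n∣≡∣m⊖n∣ : ∀ m n → ℕ.∣ m - n ∣ ≡ ∣ + m - + n ∣
∣m-n∣≡∣m⊖n∣ m n with ℕ.≤-total m n
... | inj₁ m≤n = trans (ℕ.m≤n⇒∣m-n∣≡n∸m m≤n)
  (sym (trans (cong ∣_∣ (ℤ.m-n≡m⊖n m n)) (ℤ.∣⊖∣-≤ m≤n)))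
... | inj₂ n≤m = trans (ℕ.m≤n⇒∣n-m∣≡n∸m n≤m)
  (sym (trans (cong ∣_∣ (ℤ.m-n≡m⊖n m n)) (cong ∣_∣ (ℤ.⊖-≥ n≤m))))

module _ (p : ℕ) (b : ℤ) (G H : Graph) where
  private
    module G = Graph G
    module H = Graph H
    n = G.order
  open Congruence p
  open Labeling G H

  label : Fin n → ℤ
  label i = edgeLabel p (F 0ℤ b (suc (toℕ i)))

  -- All edges of `G` have label 0. In the `i`-th copy the n spokes and the inner edges share
  -- `label i`, so they are counted as one block of constant size.
  edgeCount-labeling : (orders : H.order ≡ G.order) → IsPeriodMod p 0ℤ b (suc n) →
    (∀ x → edgeLabel p (x + x) ≡ edgeLabel p x) ⊎ H.size ≡ 0 → ∀ c →
    edgeCount p 0ℤ b (G ∘ᶜ H) (labeling orders) c ≡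
      G.size ℕ.* 𝟙 (0ℤ ℤ.≟ c) ℕ.+ (n ℕ.+ H.size) ℕ.* ∑[ i < n ] 𝟙 (label i ℤ.≟ c)
  edgeCount-labeling orders period doubling c = begin
    edgeCount p 0ℤ b (G ∘ᶜ H) f c
      ≡⟨ length-filter-corona-edges G H (λ e → inducedLabel p 0ℤ b (G ∘ᶜ H) f e ℤ.≟ c) ⟩
    _ ≡⟨ cong₂ ℕ._+_ (length-filter-≟-const _ 0ℤ c G.edges (inj₁ base-base)) (sum-cong-≗ in-copy) ⟩
    G.size ℕ.* 𝟙 (0ℤ ℤ.≟ c) ℕ.+ ∑[ i < n ] ((n ℕ.+ H.size) ℕ.* 𝟙 (label i ℤ.≟ c))
      ≡⟨ cong (G.size ℕ.* 𝟙 (0ℤ ℤ.≟ c) ℕ.+_) (*-distribˡ-sum (n ℕ.+ H.size) (λ i → 𝟙 (label i ℤ.≟ c))) ⟨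
    G.size ℕ.* 𝟙 (0ℤ ℤ.≟ c) ℕ.+ (n ℕ.+ H.size) ℕ.* ∑[ i < n ] 𝟙 (label i ℤ.≟ c) ∎
    where
    open ≡-Reasoning
    f = labeling orders
    Fib : CoronaV G H → ℤ
    Fib w = F 0ℤ b (toℕ (Bijection.to f w))

    Fib-base : ∀ g → Fib (inj₁ g) ≈ 0ℤ
    Fib-base g = ≈-trans (≈-reflexive (cong (F 0ℤ b) (toℕ-labeling-base orders g)))
      (F-periodic period (toℕ (index orders g)) 0)

    Fib-leaf : ∀ i h → Fib (inj₂ (G.vertex i , h)) ≈ F 0ℤ b (suc (toℕ i))
    Fib-leaf i h = ≈-trans (≈-reflexive (trans
        (cong (F 0ℤ b) (toℕ-labeling-leaf orders (G.vertex i) h))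
        (cong (λ j → F 0ℤ b (suc n ℕ.* toℕ (leafIndex orders h) ℕ.+ suc (toℕ j))) (Inverse.strictlyInverseʳ G.enum i))))
      (F-periodic period (toℕ (leafIndex orders h)) (suc (toℕ i)))

    base-base : ∀ e → inducedLabel p 0ℤ b (G ∘ᶜ H) f (inj₁ (proj₁ e) , inj₁ (proj₂ e)) ≡ 0ℤ
    base-base (u , v) = edgeLabel-∣ p (Fib (inj₁ u) + Fib (inj₁ v)) (≈0⇒∣ (+-cong (Fib-base u) (Fib-base v)))

    base-leaf : ∀ i h → inducedLabel p 0ℤ b (G ∘ᶜ H) f (inj₁ (G.vertex i) , inj₂ (G.vertex i , h)) ≡ label i
    base-leaf i h = edgeLabel-resp-≈ p (≈-trans (+-cong (Fib-base (G.vertex i)) (Fib-leaf i h))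
      (≈-reflexive (ℤ.+-identityˡ _)))

    leaf-leaf : ∀ i →
      (∀ e → inducedLabel p 0ℤ b (G ∘ᶜ H) f (inj₂ (G.vertex i , proj₁ e) , inj₂ (G.vertex i , proj₂ e)) ≡ label i) ⊎ H.size ≡ 0
    leaf-leaf i = Sum.map₁ (λ double (h , h′) →
      trans (edgeLabel-resp-≈ p (+-cong (Fib-leaf i h) (Fib-leaf i h′))) (double (F 0ℤ b (suc (toℕ i))))) doubling

    in-copy : ∀ i →
      ∑[ j < H.order ] 𝟙 (inducedLabel p 0ℤ b (G ∘ᶜ H) f (inj₁ (G.vertex i) , inj₂ (G.vertex i , H.vertex j)) ℤ.≟ c)
        ℕ.+ length (filter (λ (u , v) → inducedLabel p 0ℤ b (G ∘ᶜ H) f (inj₂ (G.vertex i , u) , inj₂ (G.vertex i , v)) ℤ.≟ c) H.edges)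
      ≡ (n ℕ.+ H.size) ℕ.* 𝟙 (label i ℤ.≟ c)
    in-copy i = trans (cong₂ ℕ._+_
        (trans (sum-cong-≗ λ j → cong (λ z → 𝟙 (z ℤ.≟ c)) (base-leaf i (H.vertex j)))
               (trans (sum-const H.order (𝟙 (label i ℤ.≟ c))) (cong (ℕ._* 𝟙 (label i ℤ.≟ c)) orders)))
        (length-filter-≟-const _ (label i) c H.edges (leaf-leaf i)))
      (sym (ℕ.*-distribʳ-+ (𝟙 (label i ℤ.≟ c)) n H.size))
      where
      sum-const : ∀ k x → ∑[ j < k ] x ≡ k ℕ.* x
      sum-const zero    x = refl
      sum-const (suc k) x = cong (x ℕ.+_) (sum-const k x)

theorem3p7 : ∀ (b : ℤ) → b ≢ 0ℤ →
    ∀ (k : ℤ) → -1ℤ ≤ k → k ∈χ[ 0ℤ , b ] →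
    ∀ (p : ℕ) → OddPrime p → IsPL k p 0ℤ b →
    ∀ (π : ℕ) → IsPisanoPeriod p 0ℤ b π →
    ∀ (m : ℕ) (H : Graph) → Graph.order H ≡ π ∸ 1 → Graph.size H ≡ m →
    ∀ (ε : ℤ) → (ε ≡ -1ℤ ⊎ ε ≡ 0ℤ ⊎ ε ≡ 1ℤ) →
    ∀ (G : Graph) → Graph.Connected G → Graph.order G ≡ π ∸ 1 →
    + Graph.size G ≡ (k + 1ℤ) * (+ m + + π - 1ℤ) + ε →
    ((+ p) ≡ 1ℤ [mod 8 ] ⊎ (+ p) ≡ -1ℤ [mod 8 ] ⊎ m ≡ 0) →
    IsFLC p 0ℤ b (G ∘ᶜ H)
theorem3p7 b _ k _ _ p (p-prime , p-odd) (t , t-pisano , k≡) π π-pisano m H H-order H-size ε ε-cases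
  G G-connected G-order G-size p≡±1∨m≡0 =
  corona-connected G H G-connected , labeling orders , (begin
    ℕ.∣ e 0ℤ - e 1ℤ ∣ ≡⟨ ∣m-n∣≡∣m⊖n∣ (e 0ℤ) (e 1ℤ) ⟩
    ∣ + e 0ℤ - + e 1ℤ ∣ ≡⟨ cong ∣_∣ difference≡ε ⟩
    ∣ ε ∣               ≤⟨ ∣ε∣≤1 ε-cases ⟩
    1                   ∎)
  where
  open ℕ.≤-Reasoning
  open Labeling G H
  n = Graph.order G
  s = Graph.size G
  orders : Graph.order H ≡ n
  orders = trans H-order (sym G-order)

  -- The period is positive, so the truncated subtraction `π ∸ 1` can be undone.
  suc-n≡π : suc n ≡ π
  suc-n≡π = trans (cong suc G-order) (ℕ.m+[n∸m]≡n (IsPisanoPeriod.positive π-pisano))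

  suc-n-pisano : IsPisanoPeriod p 0ℤ b (suc n)
  suc-n-pisano = subst (IsPisanoPeriod p 0ℤ b) (sym suc-n≡π) π-pisano

  doubling : (∀ x → edgeLabel p (x + x) ≡ edgeLabel p x) ⊎ Graph.size H ≡ 0
  doubling = from p≡±1∨m≡0
    where
    from : (+ p) ≡ 1ℤ [mod 8 ] ⊎ (+ p) ≡ -1ℤ [mod 8 ] ⊎ m ≡ 0 → _
    from (inj₁ q)        = inj₁ (edgeLabel-double p p-prime p-odd (PrimeModulus.2-isSquare p p-prime p-odd (inj₁ q)))
    from (inj₂ (inj₁ q)) = inj₁ (edgeLabel-double p p-prime p-odd (PrimeModulus.2-isSquare p p-prime p-odd (inj₂ q)))
    from (inj₂ (inj₂ q)) = inj₂ (trans H-size q)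

  e : ℤ → ℕ
  e = edgeCount p 0ℤ b (G ∘ᶜ H) (labeling orders)

  leg : Fin n → ℤ
  leg i = legendre (F 0ℤ b (suc (toℕ i))) p

  N : ℤ → ℕ
  N j = ∑[ i < n ] 𝟙 (leg i ℤ.≟ j)

  legendre-0 : legendre 0ℤ p ≡ 0ℤ
  legendre-0 = legendre-∣ p 0ℤ (Congruence.≈0⇒∣ p (Congruence.≈-refl p))

  Λ-count : ∀ j → length (Λ p 0ℤ b t j) ≡ 𝟙 (0ℤ ℤ.≟ j) ℕ.+ N j
  Λ-count j = trans (cong (λ t → length (Λ p 0ℤ b t j)) (pisanoPeriod-unique t-pisano suc-n-pisano))
    (trans (length-Λ p 0ℤ b n j) (cong (λ z → 𝟙 (z ℤ.≟ j) ℕ.+ N j) legendre-0))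

  -- The extra 1 comes from the index 0: F_0 = 0 has Legendre symbol 0. Hence k + 1 is the excess
  -- over the indices 1, ..., n alone.
  k≡′ : k ≡ + N 1ℤ - + N -1ℤ - (1ℤ + + N 0ℤ)
  k≡′ = trans k≡ (cong₂ (λ x y → x - + y)
    (cong₂ (λ x y → + x - + y) (Λ-count 1ℤ) (Λ-count -1ℤ)) (Λ-count 0ℤ))

  labels-0 : ∑[ i < n ] 𝟙 (label p b G H i ℤ.≟ 0ℤ) ≡ N -1ℤ ℕ.+ N 0ℤ
  labels-0 = trans (sum-cong-≗ {n} (λ i → 𝟙-edgeLabel-0 p (F 0ℤ b (suc (toℕ i)))))
    (∑-distrib-+ {n} (λ i → 𝟙 (leg i ℤ.≟ -1ℤ)) (λ i → 𝟙 (leg i ℤ.≟ 0ℤ)))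

  labels-1 : ∑[ i < n ] 𝟙 (label p b G H i ℤ.≟ 1ℤ) ≡ N 1ℤ
  labels-1 = sum-cong-≗ {n} (λ i → 𝟙-edgeLabel-1 p (F 0ℤ b (suc (toℕ i))))

  -- The factor `𝟙 (0ℤ ℤ.≟ c)` evaluates to 1 for c = 0 and to 0 for c = 1, so the edges of `G`
  -- enter only here and not in `e₁`.
  e₀ : + e 0ℤ ≡ + s + (+ n + + m) * (+ N -1ℤ + + N 0ℤ)
  e₀ = trans (cong +_ (trans (edgeCount-labeling p b G H orders (IsPisanoPeriod.period suc-n-pisano) doubling 0ℤ)
      (cong₂ ℕ._+_ (ℕ.*-identityʳ s) (cong₂ (λ x y → (n ℕ.+ x) ℕ.* y) H-size labels-0))))
    (cong (λ z → + s + z) (ℤ.pos-* (n ℕ.+ m) (N -1ℤ ℕ.+ N 0ℤ)))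

  e₁ : + e 1ℤ ≡ (+ n + + m) * + N 1ℤ
  e₁ = trans (cong +_ (trans (edgeCount-labeling p b G H orders (IsPisanoPeriod.period suc-n-pisano) doubling 1ℤ)
      (cong₂ ℕ._+_ (ℕ.*-zeroʳ s) (cong₂ (λ x y → (n ℕ.+ x) ℕ.* y) H-size labels-1))))
    (ℤ.pos-* (n ℕ.+ m) (N 1ℤ))

  s≡ : + s ≡ (+ N 1ℤ - + N -1ℤ - (1ℤ + + N 0ℤ) + 1ℤ) * (+ m + (1ℤ + + n) - 1ℤ) + ε
  s≡ = trans G-size (cong₂ (λ k π → (k + 1ℤ) * (+ m + π - 1ℤ) + ε) k≡′ (cong +_ (sym suc-n≡π)))

  -- Write A, B, C for `N 1ℤ`, `N -1ℤ`, `N 0ℤ`. Then k + 1 = A - B - C, so the size of `G` is (A - B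
  -- - C)(m + n) + ε, which offsets the surplus (n + m)(A - B - C) of label 1 up to ε.
  difference≡ε : + e 0ℤ - + e 1ℤ ≡ ε
  difference≡ε = trans (cong₂ _-_ (trans e₀ (cong (λ z → z + (+ n + + m) * (+ N -1ℤ + + N 0ℤ)) s≡)) e₁)
    (lem (+ n) (+ m) (+ N 1ℤ) (+ N -1ℤ) (+ N 0ℤ) ε)
    where
    lem : ∀ n m A B C ε → (A - B - (1ℤ + C) + 1ℤ) * (m + (1ℤ + n) - 1ℤ) + ε + (n + m) * (B + C) - (n + m) * A ≡ ε
    lem = solve-∀

  ∣ε∣≤1 : ε ≡ -1ℤ ⊎ ε ≡ 0ℤ ⊎ ε ≡ 1ℤ → ∣ ε ∣ ℕ.≤ 1
  ∣ε∣≤1 (inj₁ refl)        = s≤s z≤n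
  ∣ε∣≤1 (inj₂ (inj₁ refl)) = z≤n
  ∣ε∣≤1 (inj₂ (inj₂ refl)) = s≤s z≤n
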